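{- Let $m\ge 1$ and let $X\subset \sqrt{m}\,\mathbb{S}^{m-1}=\{\bm{x}\in\mathbb{R}^m:\bm{x}\cdot\bm{x}=m\}$ be a spherical $2$-design with $|X|=n$ which is an $s$-distance set and whose degree $S$ equals $s$. Let $F_0,\dots,F_s$ be its projection matrices, let $m_s(\bm{x})=n(F_s)_{\bm{x},\bm{x}}$ for $\bm{x}\in X$, and let $q_s$ be the predegree polynomial of degree $s$ of $X$. Then \[ \mathrm{tr}\, F_s=\frac{1}{n}\sum_{\bm{x}\in X} m_s(\bm{x})\le q_s(m), \] and equality holds if and only if $X$ has the structure of a $Q$-polynomial association scheme with respect to the idempotents $F_0,\dots,F_s$.
   Context: Setting: $\bm{x}\cdot\bm{y}$ is the standard inner product on $\mathbb{R}^m$; $X$ is a finite subset of $\sqrt{m}\,\mathbb{S}^{m-1}$ with $n=|X|$. Put $A(X)=\{\bm{x}\cdot\bm{y}:\bm{x},\bm{y}\in X,\ \bm{x}\ne\bm{y}\}$ and $A'(X)=A(X)\cup\{m\}$; $X$ is an $s$-distance set if $|A(X)|=s$. $X$ is a spherical $2$-design if the average of every polynomial of degree at most $2$ over $X$ equals its average over the sphere with respect to the Lebesgue measure (equivalently, $\sum_{\bm{y}\in X}\bm{x}\cdot\bm{y}=0$ and $\frac1n\sum_{\bm{z}\in X}(\bm{x}\cdot\bm{z})(\bm{z}\cdot\bm{y})=\bm{x}\cdot\bm{y}$ for all $\bm{x},\bm{y}\in X$). Functions: $C(X)$ is the space of real functions on $X$ with inner product $(f,g)=\frac1n\sum_{\bm{x}\in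 X}f(\bm{x})g(\bm{x})$. For $p\in\mathbb{R}[t]$ and $\bm{a}\in X$, $\zeta_{\bm{a}}(p)(\bm{x})=p(\bm{a}\cdot\bm{x})$. $\mathrm{Pol}_0(X)$ = constant functions; $\mathrm{Pol}_1(X)=\mathrm{Span}\{\zeta_{\bm a}(p):\bm a\in X,\deg p\le 1\}$; $\mathrm{Pol}_k(X)=\mathrm{Span}\{fg: f\in\mathrm{Pol}_1(X), g\in\mathrm{Pol}_{k-1}(X)\}$ for $k\ge2$ (equivalently $\mathrm{Pol}_k(X)=\mathrm{Span}\{\zeta_{\bm a}(p):\bm a\in X,\deg p\le k\}$). The degree of $X$ is $S=\min\{i:\mathrm{Pol}_i(X)=C(X)\}$. $\mathrm{Harm}_0(X)=\mathrm{Pol}_0(X)$ and $\mathrm{Harm}_k(X)=\mathrm{Pol}_k(X)\cap\mathrm{Pol}_{k-1}(X)^\perp$ for $k\ge1$. Matrices $M$ indexed by $X\times X$ act on $C(X)$ by $(Mf)(\bm x)=\sum_{\bm y}M_{\bm x,\bm y}f(\bm y)$; $F_i$ ($0\le i\le S$) is the matrix of the orthogonal projection of $C(X)$ onto $\mathrm{Harm}_i(X)$ (the projection matrices of $X$). Gram matrix and polynomials: $G=\frac1n(\bm x\cdot\bm y)_{\bm x,\bm y\in X}$. For a matrix $M$ and $p\in\mathbb{R}[t]$, $p(M^\circ)$ is the matrix obtained by applying $p$ entrywise. For $\alpha\in A'(X)$, $\kappa_\alpha=|\{(\bm x,\bm y)\in X^2:\bm x\cdot\bm y=\alpha\}|$.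 On $\mathbb{R}[t]/(\prod_{\alpha\in A'(X)}(t-\alpha))$ define $\langle p,q\rangle=\frac1{n^2}\sum_{\alpha\in A'(X)}\kappa_\alpha p(\alpha)q(\alpha)$. The predegree polynomials $q_0,\dots,q_s$ of $X$ are the polynomials with $\deg q_k=k$ and $\langle q_k,q_h\rangle=\delta_{k,h}q_k(m)$. Association schemes: for $\alpha\in A'(X)$ let $R_\alpha=\{(\bm x,\bm y)\in X^2:\bm x\cdot\bm y=\alpha\}$. "$X$ has the structure of a $Q$-polynomial association scheme with respect to the idempotents $F_0,\dots,F_s$" means: $(X,\{R_\alpha\}_{\alpha\in A'(X)})$ is a symmetric association scheme (its adjacency matrices span an algebra closed under matrix multiplication, with the usual axioms), its primitive idempotents are $F_0,\dots,F_s$, and for each $i$ there is a polynomial $v_i^*$ of degree $i$ with $nF_i=v_i^*((nF_1)^\circ)$. -}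

module Defs where

open import Algebra.Bundles using (CommutativeRing)
import Algebra.Properties.Semiring.Mult
import Algebra.Properties.Semiring.Sum
import Algebra.Properties.Semiring.Exp
open import Data.Bool.Base using (if_then_else_)
open import Data.Fin.Base using (Fin; zero; suc; toℕ; fromℕ)
open import Data.List.Base using (length; filter; cartesianProduct; allFin)
open import Data.Nat.Base as ℕ using (ℕ; zero; suc)
open import Data.Product.Base using (Σ; ∃; ∃-syntax; _×_; _,_; proj₁; proj₂)
open import Data.Sum.Base using (_⊎_)
open import Data.Vec.Functional using (Vector; _∷_)
open import Function.Bundles using (_⇔_)
open import Level using (0ℓ)
open import Relation.Binary.PropositionalEquality.Core using (_≡_; _≢_)
open import Relation.Binary.Structures using (IsDecTotalOrder)
open import Relation.Nullary.Decidable.Core using (Dec; does)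
open import Relation.Nullary.Negation.Core using (¬_)

-- The real numbers, given by the axioms of a (Dedekind-)complete ordered
-- field, which determine ℝ up to isomorphism.  Decidability of the order is
-- the classical trichotomy law.  The value of 0# ⁻¹ is unspecified.
record RealNumbers : Set₁ where
  infix  4 _≤_
  infix  8 _⁻¹
  field
    commutativeRing : CommutativeRing 0ℓ 0ℓ
  open CommutativeRing commutativeRing public
  field
    _⁻¹             : Carrier → Carrier
    ⁻¹-cong         : ∀ {x y} → x ≈ y → x ⁻¹ ≈ y ⁻¹
    ⁻¹-inverseʳ     : ∀ {x} → ¬ (x ≈ 0#) → x * x ⁻¹ ≈ 1#
    0≉1             : ¬ (0# ≈ 1#)
    _≤_             : Carrier → Carrier → Set
    isDecTotalOrder : IsDecTotalOrder _≈_ _≤_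
    +-monoˡ-≤       : ∀ {x y} z → x ≤ y → x + z ≤ y + z
    *-nonNegative   : ∀ {x y} → 0# ≤ x → 0# ≤ y → 0# ≤ x * y

  UpperBound : (Carrier → Set) → Carrier → Set
  UpperBound P u = ∀ x → P x → x ≤ u

  field
    supremum : (P : Carrier → Set) → ∃ P → ∃ (UpperBound P) →
               ∃[ u ] UpperBound P u × (∀ v → UpperBound P v → u ≤ v)

open RealNumbers {{...}} public using (_≈_; _≤_) renaming (Carrier to ℝ)

module _ {{𝓡 : RealNumbers}} where

  open RealNumbers 𝓡
    using (_+_; _*_; _-_; 0#; 1#; _⁻¹; semiring; isDecTotalOrder)
  open Algebra.Properties.Semiring.Sum semiring using (sum)
  open Algebra.Properties.Semiring.Mult semiring using ()
    renaming (_×_ to _·ℕ_)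
  open Algebra.Properties.Semiring.Exp semiring using (_^_)
  open IsDecTotalOrder isDecTotalOrder using (_≟_)

  fromNat : ℕ → ℝ
  fromNat k = k ·ℕ 1#

  average : ∀ {n} → Vector ℝ n → ℝ
  average {n} f = fromNat n ⁻¹ * sum f

  infix 7 _∙_
  _∙_ : ∀ {m} → Vector ℝ m → Vector ℝ m → ℝ
  x ∙ y = sum λ i → x i * y i

  -- A real polynomial of degree at most d, as its coefficients of t⁰, …, tᵈ.
  Poly≤ : ℕ → Set
  Poly≤ d = Vector ℝ (suc d)

  eval : ∀ {d} → Poly≤ d → ℝ → ℝ
  eval p t = sum λ i → p i * t ^ toℕ i

  HasExactDegree : ∀ d → Poly≤ d → Set
  HasExactDegree d p = ¬ (p (fromℕ d) ≈ 0#)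

  -- A polynomial of degree at most 2 in m variables,
  --   constant + Σᵢ linear i · tᵢ + Σᵢⱼ quadratic i j · tᵢtⱼ.
  record MultiPoly≤2 (m : ℕ) : Set where
    field
      constant  : ℝ
      linear    : Fin m → ℝ
      quadratic : Fin m → Fin m → ℝ

    evalAt : Vector ℝ m → ℝ
    evalAt t = constant + sum (λ i → linear i * t i)
             + sum (λ i → sum λ j → quadratic i j * (t i * t j))

    -- The average over √m S^{m-1} for the normalised Lebesgue measure.  By
    -- the symmetries tᵢ ↦ - tᵢ and tᵢ ↔ tⱼ of the sphere, the average of tᵢ
    -- is 0, that of tᵢtⱼ (i ≠ j) is 0, and all tᵢ² have the same average,
    -- which is 1 because Σᵢ tᵢ² = m on the sphere.
    sphereAverage : ℝ
    sphereAverage = constant + sum (λ i → quadratic i i)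

  Matrix : ℕ → Set
  Matrix n = Fin n → Fin n → ℝ

  module _ {n : ℕ} where

    infix 4 _≋ᴹ_
    _≋ᴹ_ : Matrix n → Matrix n → Set
    M ≋ᴹ N = ∀ i j → M i j ≈ N i j

    infixl 7 _*ᴹ_
    _*ᴹ_ : Matrix n → Matrix n → Matrix n
    (M *ᴹ N) i j = sum λ k → M i k * N k j

    infixl 6 _+ᴹ_
    _+ᴹ_ : Matrix n → Matrix n → Matrix n
    (M +ᴹ N) i j = M i j + N i j

    0ᴹ : Matrix n
    0ᴹ i j = 0#

    scale : ℝ → Matrix n → Matrix n
    scale c M i j = c * M i j

    entrywise : ∀ {d} → Poly≤ d → Matrix n → Matrix n
    entrywise p M i j = eval p (M i j)

    trace : Matrix n → ℝ
    trace M = sum λ i → M i i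

    -- For M = F_s this is x ↦ m_s(x).
    localMultiplicity : Matrix n → Vector ℝ n
    localMultiplicity M i = fromNat n * M i i

  -- Symmetric association schemes on Fin n with d classes.
  module _ {n d : ℕ} (R : Fin (suc d) → Fin n → Fin n → Set)
           (R? : ∀ k i j → Dec (R k i j)) where

    adjacency : Fin (suc d) → Matrix n
    adjacency k i j = if does (R? k i j) then 1# else 0#

    BoseMesner : Matrix n → Set
    BoseMesner M = Σ (Vector ℝ (suc d)) λ c →
      M ≋ᴹ (λ i j → sum λ k → c k * adjacency k i j)

    record IsSymmetricAssociationScheme : Set where
      field
        nonempty  : ∀ k → ∃[ i ] ∃[ j ] R k i j
        diagonal  : ∀ i j → R zero i j ⇔ i ≡ j
        covering  : ∀ i j → ∃[ k ] R k i j
        disjoint  : ∀ {k l i j} → R k i j → R l i j → k ≡ l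
        symmetric : ∀ {k i j} → R k i j → R k j i
        closed    : ∀ k l → BoseMesner (adjacency k *ᴹ adjacency l)

    record IsIdempotent (E : Matrix n) : Set where
      field
        member     : BoseMesner E
        idempotent : E *ᴹ E ≋ᴹ E

    record IsPrimitiveIdempotent (E : Matrix n) : Set where
      field
        isIdempotent   : IsIdempotent E
        nonzero        : ¬ (E ≋ᴹ 0ᴹ)
        indecomposable : ∀ E′ E″ → IsIdempotent E′ → IsIdempotent E″ →
                         E′ *ᴹ E″ ≋ᴹ 0ᴹ → E″ *ᴹ E′ ≋ᴹ 0ᴹ →
                         E ≋ᴹ (E′ +ᴹ E″) → E′ ≋ᴹ 0ᴹ ⊎ E″ ≋ᴹ 0ᴹ

    -- Only F 0, …, F d are relevant.
    record PrimitiveIdempotentsAre (F : ℕ → Matrix n) : Set where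
      field
        isPrimitive : ∀ i → i ℕ.≤ d → IsPrimitiveIdempotent (F i)
        distinct    : ∀ i j → i ℕ.≤ d → j ℕ.≤ d → F i ≋ᴹ F j → i ≡ j
        all         : ∀ E → IsPrimitiveIdempotent E →
                      ∃[ i ] i ℕ.≤ d × E ≋ᴹ F i

  -- A finite subset of ℝᵐ with n elements is given as an injective family
  -- indexed by Fin n.
  module _ {m n : ℕ} (X : Fin n → Vector ℝ m) where

    AreDistinct : Set
    AreDistinct = ∀ i j → (∀ l → X i l ≈ X j l) → i ≡ j

    OnSphere : Set
    OnSphere = ∀ i → X i ∙ X i ≈ fromNat m

    IsSpherical2Design : Set
    IsSpherical2Design = ∀ (p : MultiPoly≤2 m) → let open MultiPoly≤2 p in
      average (λ i → evalAt (X i)) ≈ sphereAverage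

    A : ℝ → Set
    A a = ∃[ i ] ∃[ j ] i ≢ j × a ≈ X i ∙ X j

    -- |A(X)| = s, witnessed by a list α of the elements of A(X) without
    -- repetition.
    record IsDistanceSet (s : ℕ) (α : Vector ℝ s) : Set where
      field
        injective : ∀ k l → α k ≈ α l → k ≡ l
        sound     : ∀ k → A (α k)
        complete  : ∀ a → A a → ∃[ k ] a ≈ α k

    C : Set
    C = Vector ℝ n

    inner : C → C → ℝ
    inner f g = average λ i → f i * g i

    ζ : ∀ {d} → Fin n → Poly≤ d → C
    ζ a p i = eval p (X a ∙ X i)

    Span : (C → Set) → C → Set
    Span P f = ∃[ N ] Σ (Vector ℝ N) λ c → Σ (Vector C N) λ g →
      (∀ l → P (g l)) × (∀ i → f i ≈ sum λ l → c l * g l i)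

    Pol₀ Pol₁ : C → Set
    Pol₀ f = Σ ℝ λ c → ∀ i → f i ≈ c
    Pol₁ = Span λ f → ∃[ a ] Σ (Poly≤ 1) λ p → ∀ i → f i ≈ ζ a p i

    Pol : ℕ → C → Set
    Pol 0             = Pol₀
    Pol 1             = Pol₁
    Pol (suc (suc k)) = Span λ h → ∃[ f ] ∃[ g ]
      Pol₁ f × Pol (suc k) g × (∀ i → h i ≈ f i * g i)

    PolIsEverything : ℕ → Set
    PolIsEverything k = ∀ f → Pol k f

    HasDegree : ℕ → Set
    HasDegree S = PolIsEverything S × (∀ i → i ℕ.< S → ¬ PolIsEverything i)

    Harm : ℕ → C → Set
    Harm zero    f = Pol 0 f
    Harm (suc k) f = Pol (suc k) f × (∀ g → Pol k g → inner f g ≈ 0#)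

    apply : Matrix n → C → C
    apply M f i = sum λ j → M i j * f j

    IsOrthogonalProjectionOnto : (C → Set) → Matrix n → Set
    IsOrthogonalProjectionOnto W M = ∀ f →
      W (apply M f) × (∀ g → W g → inner (λ i → f i - apply M f i) g ≈ 0#)

    AreProjectionMatrices : ℕ → (ℕ → Matrix n) → Set
    AreProjectionMatrices S F =
      ∀ i → i ℕ.≤ S → IsOrthogonalProjectionOnto (Harm i) (F i)

    module _ {s : ℕ} (α : Vector ℝ s) where

      -- A′(X) = A(X) ∪ {m}, with m listed first.
      A′ : Vector ℝ (suc s)
      A′ = fromNat m ∷ α

      R : Fin (suc s) → Fin n → Fin n → Set
      R k i j = X i ∙ X j ≈ A′ k

      R? : ∀ k i j → Dec (R k i j)
      R? k i j = X i ∙ X j ≟ A′ k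

      κ : Fin (suc s) → ℕ
      κ k = length (filter (λ ij → R? k (proj₁ ij) (proj₂ ij))
                           (cartesianProduct (allFin n) (allFin n)))

      ⟨_,_⟩ : ∀ {d e} → Poly≤ d → Poly≤ e → ℝ
      ⟨ p , q ⟩ = (fromNat n * fromNat n) ⁻¹
                * sum (λ k → fromNat (κ k) * (eval p (A′ k) * eval q (A′ k)))

      -- Only q 0, …, q s are relevant.
      record ArePredegreePolynomials (q : ∀ k → Poly≤ k) : Set where
        field
          degree     : ∀ k → k ℕ.≤ s → HasExactDegree k (q k)
          norm       : ∀ k → k ℕ.≤ s → ⟨ q k , q k ⟩ ≈ eval (q k) (fromNat m)
          orthogonal : ∀ k h → k ℕ.≤ s → h ℕ.≤ s → k ≢ h →
                       ⟨ q k , q h ⟩ ≈ 0#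

      record IsQPolynomialScheme (F : ℕ → Matrix n) : Set where
        field
          isScheme    : IsSymmetricAssociationScheme R R?
          idempotents : PrimitiveIdempotentsAre R R? F
          qPolynomial : ∀ i → i ℕ.≤ s → Σ (Poly≤ i) λ v → HasExactDegree i v ×
            scale (fromNat n) (F i) ≋ᴹ entrywise v (scale (fromNat n) (F 1))

{-# OPTIONS --safe #-}

-- Write E_k for the matrix (1/n) q_k(x·y).  With the Hilbert–Schmidt inner
-- product, ⟨p, q⟩ is the inner product of (1/n) p(x·y) and (1/n) q(x·y), so the
-- E_k are orthogonal with ‖E_k‖² = q_k(m), and I = Σ_k E_k because the q_k form a
-- basis of the functions on A′(X).  The columns of E_k lie in Pol_k, hence F_s is
-- orthogonal to E_k for k < s, so ⟪F_s, E_s⟫ = tr F_s = ‖F_s‖² and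
--   q_s(m) = tr F_s + ‖E_s − F_s‖².
-- This is the inequality, with equality iff E_s = F_s.  If E_s = F_s, the
-- three-term recurrence for t q_{k+1} shows, by descending induction, that the
-- columns of E_k lie in Harm_k, whence E_k = F_k for every k; the F_k are then a
-- basis of orthogonal idempotents of the Bose–Mesner algebra.  Conversely, in a
-- Q-polynomial scheme F_s = (1/n) v(x·y) with deg v = s (since n F_1 is the Gram
-- matrix of a 2-design), so F_s is a multiple of E_s, and comparing inner
-- products with F_s shows that the factor is 1.
module Submission where

open import Defs
import Algebra.Properties.Ring
import Algebra.Properties.Semiring.Exp
import Algebra.Properties.Semiring.Mult
import Algebra.Properties.Semiring.Sum
import Algebra.Solver.Ring.NaturalCoefficients.Default
open import Data.Bool.Base using (true; false; if_then_else_)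
open import Data.Empty using (⊥-elim)
open import Data.Fin.Base using (Fin; zero; suc; toℕ; fromℕ; fromℕ<; inject₁; inject≤)
open import Data.Fin.Properties as Fin using (toℕ-inject₁; toℕ-fromℕ; toℕ-fromℕ<; toℕ-injective; toℕ<n; any?; inject≤-injective)
open import Data.List.Base using (length; filter; map; _++_; tabulate; cartesianProduct)
open import Data.List.Properties using (filter-++; length-++; map-tabulate)
open import Data.Nat.Base as ℕ using (ℕ; zero; suc; z≤n; s≤s)
open import Data.Nat.Properties as ℕₚ using (≤⇒≤′)
open import Data.Product.Base using (Σ; ∃-syntax; _×_; _,_; proj₁; proj₂)
open import Data.Sum.Base using (_⊎_; inj₁; inj₂; [_,_]′)
open import Data.Vec.Functional using (Vector; _∷_; tail; init)
open import Function.Base using (_∘_; id)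
open import Function.Bundles using (_⇔_; mk⇔)
open import Relation.Binary.Definitions using (tri<; tri≈; tri>)
open import Relation.Binary.PropositionalEquality.Core as ≡ using (_≡_; _≢_)
import Relation.Binary.Reasoning.Setoid
open import Relation.Binary.Structures using (IsDecTotalOrder)
open import Relation.Nullary.Decidable using (¬?; decidable-stable)
open import Relation.Nullary.Decidable.Core using (Dec; yes; no; does)
open import Relation.Nullary.Negation.Core using (¬_; contradiction)

-- The `E k` are orthogonal only as vectors for `⟪_,_⟫`. Nothing is known beforehand about their
-- matrix products, nor about the columns of `E k` against functions of lower degree. One half of
-- the comparison is free: `F k` annihilates `E l` for l < k, since those columns have degree below
-- k; for l > k there is no such control. At the top degree s no larger l remains. This is why the
-- inequality concerns `F s`, and why equality must travel downwards: the missing facts about l > k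
-- are supplied by the equalities of `E l` and `F l` already reached. The normalisation of q_k to
-- squared norm q_k(m), rather than 1, gives the identity matrix all its coefficients equal to 1, so
-- the trace of `F s` appears without weights. No dimension of a harmonic space is computed:
-- nonvanishing comes from traces, and equality of matrices from definiteness of `⟪_,_⟫`.

module _ {{𝓡 : RealNumbers}} where

  open RealNumbers 𝓡 hiding (_≈_; _≤_; Carrier; zero)
  open IsDecTotalOrder isDecTotalOrder using (_≟_; total; antisym; ≤-respʳ-≈; ≤-respˡ-≈)
    renaming (trans to ≤-trans; refl to ≤-refl)
  open Algebra.Properties.Ring ring
  open Algebra.Properties.Semiring.Sum semiring
  open Algebra.Properties.Semiring.Mult semiring using (×-homo-+)
  open Algebra.Properties.Semiring.Exp semiring
  open Algebra.Solver.Ring.NaturalCoefficients.Default commutativeSemiring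
    using (solve; _:=_; _:+_; _:*_)
  open Relation.Binary.Reasoning.Setoid setoid

  -- Ordered fields

  -- Differences are kept as single atoms later on; after this splitting, identities with
  -- subtraction follow from the commutative semiring laws.
  x≈y+[x-y] : ∀ x y → x ≈ y + (x - y)
  x≈y+[x-y] x y = begin
    x              ≈⟨ +-identityˡ x ⟨
    0# + x         ≈⟨ +-congʳ (-‿inverseʳ y) ⟨
    (y - y) + x    ≈⟨ solve 3 (λ y z x → (y :+ z) :+ x := y :+ (x :+ z)) refl y (- y) x ⟩
    y + (x - y)    ∎

  x-y≈0⇒x≈y : ∀ {x y} → x - y ≈ 0# → x ≈ y
  x-y≈0⇒x≈y {x} {y} p = trans (x≈y+[x-y] x y) (trans (+-congˡ p) (+-identityʳ y))

  x≈y⇒x-y≈0 : ∀ {x y} → x ≈ y → x - y ≈ 0#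
  x≈y⇒x-y≈0 {x} {y} p = trans (+-congʳ p) (-‿inverseʳ y)

  *-cancel-0 : ∀ {x y} → ¬ x ≈ 0# → x * y ≈ 0# → y ≈ 0#
  *-cancel-0 {x} {y} x≉0 xy≈0 = begin
    y                ≈⟨ *-identityʳ y ⟨
    y * 1#           ≈⟨ *-congˡ (⁻¹-inverseʳ x≉0) ⟨
    y * (x * x ⁻¹)   ≈⟨ solve 3 (λ x y z → y :* (x :* z) := (x :* y) :* z) refl x y (x ⁻¹) ⟩
    (x * y) * x ⁻¹   ≈⟨ *-congʳ xy≈0 ⟩
    0# * x ⁻¹        ≈⟨ zeroˡ _ ⟩
    0#               ∎

  *-cancelˡ : ∀ {x y z} → ¬ x ≈ 0# → x * y ≈ x * z → y ≈ z
  *-cancelˡ {x} {y} {z} x≉0 e = x-y≈0⇒x≈y (*-cancel-0 x≉0 (begin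
    x * (y - z)        ≈⟨ distribˡ x y (- z) ⟩
    x * y + x * (- z)  ≈⟨ +-congˡ (-‿distribʳ-* x z) ⟨
    x * y - x * z      ≈⟨ x≈y⇒x-y≈0 e ⟩
    0#                 ∎))

  ⁻¹*-cancel : ∀ {x} y → ¬ x ≈ 0# → x * (x ⁻¹ * y) ≈ y
  ⁻¹*-cancel {x} y x≉0 =
    trans (sym (*-assoc _ _ _)) (trans (*-congʳ (⁻¹-inverseʳ x≉0)) (*-identityˡ y))

  ⁻¹-nonzero : ∀ {x} → ¬ x ≈ 0# → ¬ x ⁻¹ ≈ 0#
  ⁻¹-nonzero {x} x≉0 e = 0≉1 (begin
    0#        ≈⟨ zeroʳ x ⟨
    x * 0#    ≈⟨ *-congˡ e ⟨
    x * x ⁻¹  ≈⟨ ⁻¹-inverseʳ x≉0 ⟩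
    1#        ∎)

  *-nonzero : ∀ {x y} → ¬ x ≈ 0# → ¬ y ≈ 0# → ¬ x * y ≈ 0#
  *-nonzero x≉0 y≉0 e = y≉0 (*-cancel-0 x≉0 e)

  x*x≈0⇒x≈0 : ∀ {x} → x * x ≈ 0# → x ≈ 0#
  x*x≈0⇒x≈0 {x} e with x ≟ 0#
  ... | yes x≈0 = x≈0
  ... | no  x≉0 = *-cancel-0 x≉0 e

  0≤x*x : ∀ x → 0# ≤ x * x
  0≤x*x x with total 0# x
  ... | inj₁ 0≤x = *-nonNegative 0≤x 0≤x
  ... | inj₂ x≤0 = ≤-respʳ-≈ -x*-x≈x*x (*-nonNegative 0≤-x 0≤-x)
    where
    0≤-x : 0# ≤ - x
    0≤-x = ≤-respʳ-≈ (+-identityˡ _) (≤-respˡ-≈ (-‿inverseʳ x) (+-monoˡ-≤ (- x) x≤0))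
    -x*-x≈x*x : - x * - x ≈ x * x
    -x*-x≈x*x = trans (sym (-‿distribˡ-* x (- x)))
      (trans (-‿cong (sym (-‿distribʳ-* x x))) (-‿involutive _))

  +-nonNegative : ∀ {x y} → 0# ≤ x → 0# ≤ y → 0# ≤ x + y
  +-nonNegative {x} {y} 0≤x 0≤y = ≤-trans 0≤y (≤-respˡ-≈ (+-identityˡ y) (+-monoˡ-≤ y 0≤x))

  x≤x+y : ∀ {x y} → 0# ≤ y → x ≤ x + y
  x≤x+y {x} {y} 0≤y = ≤-respʳ-≈ (+-comm y x) (≤-respˡ-≈ (+-identityˡ x) (+-monoˡ-≤ x 0≤y))

  x+y≈0⇒x≈0 : ∀ {x y} → 0# ≤ x → 0# ≤ y → x + y ≈ 0# → x ≈ 0#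
  x+y≈0⇒x≈0 0≤x 0≤y e = antisym (≤-respʳ-≈ e (x≤x+y 0≤y)) 0≤x

  fromNat-nonNegative : ∀ n → 0# ≤ fromNat n
  fromNat-nonNegative zero    = ≤-refl
  fromNat-nonNegative (suc n) =
    +-nonNegative (≤-respʳ-≈ (*-identityˡ 1#) (0≤x*x 1#)) (fromNat-nonNegative n)

  -- An ordered field has characteristic zero: 1 = 1 · 1 is nonnegative, so a vanishing sum of ones
  -- would make the first of them vanish.
  fromNat-nonzero : ∀ {n} → 1 ℕ.≤ n → ¬ fromNat n ≈ 0#
  fromNat-nonzero {suc n} _ e = 0≉1 (sym
    (x+y≈0⇒x≈0 (≤-respʳ-≈ (*-identityˡ 1#) (0≤x*x 1#)) (fromNat-nonNegative n) e))

  -- Finite sums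

  sum-zero : ∀ {n} {f : Vector ℝ n} → (∀ i → f i ≈ 0#) → sum f ≈ 0#
  sum-zero {n} f≈0 = trans (sum-cong-≋ f≈0) (sum-replicate-zero n)

  sum-const : ∀ {n} (c : ℝ) → sum {n} (λ _ → c) ≈ fromNat n * c
  sum-const {zero}  c = sym (zeroˡ c)
  sum-const {suc n} c = begin
    c + sum {n} (λ _ → c)       ≈⟨ +-congˡ (sum-const {n} c) ⟩
    c + fromNat n * c           ≈⟨ +-congʳ (*-identityˡ c) ⟨
    1# * c + fromNat n * c      ≈⟨ distribʳ c 1# (fromNat n) ⟨
    (1# + fromNat n) * c        ∎

  sum-nonNegative : ∀ {n} {f : Vector ℝ n} → (∀ i → 0# ≤ f i) → 0# ≤ sum f
  sum-nonNegative {zero}  0≤f = ≤-refl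
  sum-nonNegative {suc n} 0≤f = +-nonNegative (0≤f zero) (sum-nonNegative (0≤f ∘ suc))

  sum-nonNegative≈0 : ∀ {n} {f : Vector ℝ n} → (∀ i → 0# ≤ f i) → sum f ≈ 0# → ∀ i → f i ≈ 0#
  sum-nonNegative≈0 0≤f e zero    = x+y≈0⇒x≈0 (0≤f zero) (sum-nonNegative (0≤f ∘ suc)) e
  sum-nonNegative≈0 0≤f e (suc i) = sum-nonNegative≈0 (0≤f ∘ suc)
    (x+y≈0⇒x≈0 (sum-nonNegative (0≤f ∘ suc)) (0≤f zero) (trans (+-comm _ _) e)) i

  ∙-cong : ∀ {n} {f f′ g g′ : Vector ℝ n} →
           (∀ i → f i ≈ f′ i) → (∀ i → g i ≈ g′ i) → f ∙ g ≈ f′ ∙ g′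
  ∙-cong p q = sum-cong-≋ λ i → *-cong (p i) (q i)

  ∙-comm : ∀ {n} (f g : Vector ℝ n) → f ∙ g ≈ g ∙ f
  ∙-comm f g = sum-cong-≋ λ i → *-comm (f i) (g i)

  ∙-distribʳ : ∀ {n} (f g h : Vector ℝ n) → (λ i → f i + g i) ∙ h ≈ f ∙ h + g ∙ h
  ∙-distribʳ f g h = trans (sum-cong-≋ λ i → distribʳ (h i) (f i) (g i))
    (∑-distrib-+ (λ i → f i * h i) (λ i → g i * h i))

  ∙-distribˡ : ∀ {n} (f g h : Vector ℝ n) → h ∙ (λ i → f i + g i) ≈ h ∙ f + h ∙ g
  ∙-distribˡ f g h = trans (sum-cong-≋ λ i → distribˡ (h i) (f i) (g i))
    (∑-distrib-+ (λ i → h i * f i) (λ i → h i * g i))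

  ∙-scaleˡ : ∀ {n} c (f g : Vector ℝ n) → (λ i → c * f i) ∙ g ≈ c * (f ∙ g)
  ∙-scaleˡ c f g = trans (sum-cong-≋ λ i → *-assoc c (f i) (g i)) (sym (*-distribˡ-sum c (λ i → f i * g i)))

  ∙-scaleʳ : ∀ {n} c (f g : Vector ℝ n) → f ∙ (λ i → c * g i) ≈ c * (f ∙ g)
  ∙-scaleʳ c f g = trans (∙-comm f _) (trans (∙-scaleˡ c g f) (*-congˡ (∙-comm g f)))

  ∙-split : ∀ {n} (f f′ g : Vector ℝ n) → f ∙ g ≈ f′ ∙ g + (λ i → f i - f′ i) ∙ g
  ∙-split f f′ g = trans (∙-cong (λ i → x≈y+[x-y] (f i) (f′ i)) (λ _ → refl)) (∙-distribʳ f′ _ g)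

  ∙-definite : ∀ {n} (f : Vector ℝ n) → f ∙ f ≈ 0# → ∀ i → f i ≈ 0#
  ∙-definite f e i = x*x≈0⇒x≈0 (sum-nonNegative≈0 (λ i → 0≤x*x (f i)) e i)

  -- As a `Matrix n` this is the identity matrix; its rows are the standard basis. Recursion on both
  -- indices lets sums against `δ i` collapse by induction, without an equality test.
  δ : ∀ {n} → Fin n → Vector ℝ n
  δ zero    zero    = 1#
  δ zero    (suc j) = 0#
  δ (suc i) zero    = 0#
  δ (suc i) (suc j) = δ i j

  δ-diagonal : ∀ {n} (i : Fin n) → δ i i ≈ 1#
  δ-diagonal zero    = refl
  δ-diagonal (suc i) = δ-diagonal i

  δ-offDiagonal : ∀ {n} {i j : Fin n} → i ≢ j → δ i j ≈ 0#
  δ-offDiagonal {i = zero}  {zero}  i≢j = contradiction ≡.refl i≢j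
  δ-offDiagonal {i = zero}  {suc j} i≢j = refl
  δ-offDiagonal {i = suc i} {zero}  i≢j = refl
  δ-offDiagonal {i = suc i} {suc j} i≢j = δ-offDiagonal (i≢j ∘ ≡.cong suc)

  δ-comm : ∀ {n} (i j : Fin n) → δ i j ≈ δ j i
  δ-comm zero    zero    = refl
  δ-comm zero    (suc j) = refl
  δ-comm (suc i) zero    = refl
  δ-comm (suc i) (suc j) = δ-comm i j

  δ-∙ : ∀ {n} (i : Fin n) (f : Vector ℝ n) → δ i ∙ f ≈ f i
  δ-∙ zero    f = trans (+-cong (*-identityˡ _) (sum-zero λ i → zeroˡ (f (suc i)))) (+-identityʳ _)
  δ-∙ (suc i) f = trans (+-cong (zeroˡ _) (δ-∙ i (f ∘ suc))) (+-identityˡ _)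

  ∙-δ : ∀ {n} (i : Fin n) (f : Vector ℝ n) → f ∙ δ i ≈ f i
  ∙-δ i f = trans (∙-comm f (δ i)) (δ-∙ i f)

  sum-single : ∀ {n} {f : Vector ℝ n} i → (∀ j → i ≢ j → f j ≈ 0#) → sum f ≈ f i
  sum-single zero    p = trans (+-congˡ (sum-zero λ j → p (suc j) λ ())) (+-identityʳ _)
  sum-single (suc i) p = trans (+-cong (p zero λ ())
    (sum-single i λ j i≢j → p (suc j) λ { ≡.refl → i≢j ≡.refl })) (+-identityˡ _)

  -- Polynomials

  eval-cong : ∀ {d} (p : Poly≤ d) {t u : ℝ} → t ≈ u → eval p t ≈ eval p u
  eval-cong {d} p t≈u = sum-cong-≋ {suc d} λ i → *-congˡ {p i} (^-congˡ (toℕ i) t≈u)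

  eval-constant : ∀ (p : Poly≤ 0) (t : ℝ) → eval p t ≈ p zero
  eval-constant p t = trans (+-identityʳ _) (*-identityʳ _)

  eval-∷ : ∀ {d} (p : Poly≤ (suc d)) (t : ℝ) → eval p t ≈ p zero + t * eval (tail p) t
  eval-∷ p t = +-cong (*-identityʳ _) (begin
    sum (λ i → p (suc i) * (t * t ^ toℕ i))
      ≈⟨ sum-cong-≋ (λ i → solve 3 (λ p t u → p :* (t :* u) := t :* (p :* u)) refl
           (p (suc i)) t (t ^ toℕ i)) ⟩
    sum (λ i → t * (p (suc i) * t ^ toℕ i))
      ≈⟨ *-distribˡ-sum t (λ i → p (suc i) * t ^ toℕ i) ⟨
    t * eval (tail p) t  ∎)

  eval-init-last : ∀ {d} (p : Poly≤ (suc d)) (t : ℝ) →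
                   eval p t ≈ eval (init p) t + p (fromℕ (suc d)) * t ^ suc d
  eval-init-last {d} p t = trans (sum-init-last {suc d} (λ i → p i * t ^ toℕ i)) (+-cong
    (sum-cong-≋ {suc d} λ i → *-congˡ {p (inject₁ i)} (^-congʳ t (toℕ-inject₁ i)))
    (*-congˡ (^-congʳ t (toℕ-fromℕ (suc d)))))

  eval-+ : ∀ {d} (p r : Poly≤ d) (t : ℝ) → eval (λ i → p i + r i) t ≈ eval p t + eval r t
  eval-+ p r t = ∙-distribʳ p r (λ i → t ^ toℕ i)

  eval-scale : ∀ {d} c (p : Poly≤ d) (t : ℝ) → eval (λ i → c * p i) t ≈ c * eval p t
  eval-scale c p t = ∙-scaleˡ c p (λ i → t ^ toℕ i)

  -- (p − p(a)) / (t − a).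
  quotient : ∀ {d} → ℝ → Poly≤ (suc d) → Poly≤ d
  quotient {zero}  a p = tail p
  quotient {suc d} a p = eval (tail p) a ∷ quotient a (tail p)

  -- Horner's scheme: if the tail of p is b + (t - a) r, then t (b + (t - a) r) = a b + (t - a)(b +
  -- t r).
  eval-quotient : ∀ {d} a (p : Poly≤ (suc d)) (t : ℝ) →
                  eval p t ≈ eval p a + (t - a) * eval (quotient a p) t
  eval-quotient {zero} a p t = begin
    eval p t                                 ≈⟨ linear t ⟩
    p zero + t * p₁                          ≈⟨ +-congˡ (*-congʳ (x≈y+[x-y] t a)) ⟩
    p zero + (a + (t - a)) * p₁              ≈⟨ solve 4 (λ c a h p → c :+ (a :+ h) :* p := (c :+ a :* p) :+ h :* p)
                                                  refl (p zero) a (t - a) p₁ ⟩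
    (p zero + a * p₁) + (t - a) * p₁         ≈⟨ +-cong (linear a) (*-congˡ (eval-constant (tail p) t)) ⟨
    eval p a + (t - a) * eval (tail p) t     ∎
    where
    p₁ = p (suc zero)
    linear : ∀ t → eval p t ≈ p zero + t * p₁
    linear t = trans (eval-∷ p t) (+-congˡ (*-congˡ (eval-constant (tail p) t)))
  eval-quotient {suc d} a p t = begin
    eval p t                                 ≈⟨ eval-∷ p t ⟩
    p zero + t * eval (tail p) t             ≈⟨ +-congˡ (*-cong (x≈y+[x-y] t a) (eval-quotient a (tail p) t)) ⟩
    p zero + (a + h) * (b + h * r)           ≈⟨ solve 5 (λ c a h b r → c :+ (a :+ h) :* (b :+ h :* r) :=
                                                    (c :+ a :* b) :+ h :* (b :+ (a :+ h) :* r)) refl (p zero) a h b r ⟩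
    (p zero + a * b) + h * (b + (a + h) * r) ≈⟨ +-cong (eval-∷ p a)
                                                  (*-congˡ (+-congˡ (*-congʳ (x≈y+[x-y] t a)))) ⟨
    eval p a + h * (b + t * r)               ≈⟨ +-congˡ (*-congˡ (eval-∷ (quotient a p) t)) ⟨
    eval p a + h * eval (quotient a p) t     ∎
    where
    h = t - a
    b = eval (tail p) a
    r = eval (quotient a (tail p)) t

  quotient-leading : ∀ {d} a (p : Poly≤ (suc d)) → quotient a p (fromℕ d) ≡ p (fromℕ (suc d))
  quotient-leading {zero}  a p = ≡.refl
  quotient-leading {suc d} a p = quotient-leading a (tail p)

  Distinct : ∀ {k} → Vector ℝ k → Set
  Distinct a = ∀ k l → a k ≈ a l → k ≡ l

  Distinct-tail : ∀ {k} {a : Vector ℝ (suc k)} → Distinct a → Distinct (tail a)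
  Distinct-tail dist k l e with ≡.refl ← dist (suc k) (suc l) e = ≡.refl

  Distinct-nonzero : ∀ {k} {a : Vector ℝ (suc k)} → Distinct a → ∀ i → ¬ a (suc i) - a zero ≈ 0#
  Distinct-nonzero dist i e with () ← dist (suc i) zero (x-y≈0⇒x≈y e)

  -- Dividing by t - a₀ keeps the leading coefficient and leaves a quotient that vanishes at the
  -- remaining nodes, so induction on the degree applies.
  leading-vanishes : ∀ {d} (a : Vector ℝ (suc d)) → Distinct a → (p : Poly≤ d) →
                     (∀ k → eval p (a k) ≈ 0#) → p (fromℕ d) ≈ 0#
  leading-vanishes {zero}  a dist p e = trans (sym (eval-constant p (a zero))) (e zero)
  leading-vanishes {suc d} a dist p e =
    ≡.subst (_≈ 0#) (quotient-leading (a zero) p)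
      (leading-vanishes (tail a) (Distinct-tail dist) (quotient (a zero) p) λ k →
        *-cancel-0 (Distinct-nonzero dist k) (begin
          (a (suc k) - a zero) * eval (quotient (a zero) p) (a (suc k))  ≈⟨ +-identityˡ _ ⟨
          0# + (a (suc k) - a zero) * eval (quotient (a zero) p) (a (suc k)) ≈⟨ +-congʳ (e zero) ⟨
          eval p (a zero) + (a (suc k) - a zero) * eval (quotient (a zero) p) (a (suc k))
                                                          ≈⟨ eval-quotient (a zero) p (a (suc k)) ⟨
          eval p (a (suc k))                              ≈⟨ e (suc k) ⟩
          0#                                              ∎))

  -- c + (t − a) p.
  newtonStep : ∀ {d} → ℝ → ℝ → Poly≤ d → Poly≤ (suc d)
  newtonStep {zero}  c a p = (c - a * p zero) ∷ p
  newtonStep {suc d} c a p = (c - a * p zero) ∷ newtonStep (p zero) a (tail p)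

  -- With p = p₀ + t p′, c + (t - a) p = (c - a p₀) + t (p₀ + (t - a) p′): the recursive call is the
  -- same construction with p₀ as its constant.
  eval-newtonStep : ∀ {d} c a (p : Poly≤ d) (t : ℝ) →
                    eval (newtonStep c a p) t ≈ c + (t - a) * eval p t
  eval-newtonStep {zero} c a p t = begin
    eval (newtonStep c a p) t     ≈⟨ eval-∷ (newtonStep c a p) t ⟩
    (c - ap) + t * eval p t       ≈⟨ +-congˡ (*-cong (x≈y+[x-y] t a) (eval-constant p t)) ⟩
    (c - ap) + (a + h) * p zero   ≈⟨ solve 4 (λ c′ a h p → c′ :+ (a :+ h) :* p := (a :* p :+ c′) :+ h :* p)
                                       refl (c - ap) a h (p zero) ⟩
    (ap + (c - ap)) + h * p zero  ≈⟨ +-cong (x≈y+[x-y] c ap) (*-congˡ (eval-constant p t)) ⟨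
    c + h * eval p t              ∎
    where
    ap = a * p zero
    h = t - a
  eval-newtonStep {suc d} c a p t = begin
    eval (newtonStep c a p) t                    ≈⟨ eval-∷ (newtonStep c a p) t ⟩
    (c - ap) + t * eval (newtonStep (p zero) a (tail p)) t
                                                 ≈⟨ +-congˡ (*-congˡ (eval-newtonStep (p zero) a (tail p) t)) ⟩
    (c - ap) + t * (p zero + h * e)              ≈⟨ +-congˡ (*-congʳ (x≈y+[x-y] t a)) ⟩
    (c - ap) + (a + h) * (p zero + h * e)        ≈⟨ solve 5 (λ c′ a h p e → c′ :+ (a :+ h) :* (p :+ h :* e) :=
                                                      (a :* p :+ c′) :+ h :* (p :+ (a :+ h) :* e))
                                                      refl (c - ap) a h (p zero) e ⟩
    (ap + (c - ap)) + h * (p zero + (a + h) * e) ≈⟨ +-cong (x≈y+[x-y] c ap) (*-congˡ (+-congˡ (*-congʳ (x≈y+[x-y] t a)))) ⟨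
    c + h * (p zero + t * e)                     ≈⟨ +-congˡ (*-congˡ (eval-∷ p t)) ⟨
    c + h * eval p t                             ∎
    where
    ap = a * p zero
    h = t - a
    e = eval (tail p) t

  -- Newton's form: the value at the first node is the constant, and the divided differences at the
  -- other nodes are interpolated recursively.
  interpolate : ∀ {d} (a : Vector ℝ (suc d)) → Distinct a → (u : Vector ℝ (suc d)) →
                Σ (Poly≤ d) λ p → ∀ k → eval p (a k) ≈ u k
  interpolate {zero}  a dist u = u , λ { zero → eval-constant u (a zero) }
  interpolate {suc d} a dist u = newtonStep (u zero) (a zero) p , matches
    where
    h : Vector ℝ (suc d)
    h k = a (suc k) - a zero
    rest = interpolate (tail a) (Distinct-tail dist) λ k → h k ⁻¹ * (u (suc k) - u zero)
    p = proj₁ rest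
    matches : ∀ k → eval (newtonStep (u zero) (a zero) p) (a k) ≈ u k
    matches zero    = begin
      eval (newtonStep (u zero) (a zero) p) (a zero)     ≈⟨ eval-newtonStep _ _ p _ ⟩
      u zero + (a zero - a zero) * eval p (a zero)       ≈⟨ +-congˡ (*-congʳ (-‿inverseʳ (a zero))) ⟩
      u zero + 0# * eval p (a zero)                      ≈⟨ +-congˡ (zeroˡ _) ⟩
      u zero + 0#                                        ≈⟨ +-identityʳ _ ⟩
      u zero                                             ∎
    matches (suc k) = begin
      eval (newtonStep (u zero) (a zero) p) (a (suc k))  ≈⟨ eval-newtonStep _ _ p _ ⟩
      u zero + h k * eval p (a (suc k))                  ≈⟨ +-congˡ (*-congˡ (proj₂ rest k)) ⟩
      u zero + h k * (h k ⁻¹ * (u (suc k) - u zero))     ≈⟨ +-congˡ (⁻¹*-cancel _ (Distinct-nonzero dist k)) ⟩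
      u zero + (u (suc k) - u zero)                      ≈⟨ x≈y+[x-y] _ _ ⟨
      u (suc k)                                          ∎

  -- Subtracting the multiple of w with the same leading coefficient drops the degree bound in the
  -- type; every induction on degree below rests on this.
  eliminate-leading : ∀ {d} (p w : Poly≤ (suc d)) → HasExactDegree (suc d) w →
    Σ ℝ λ c → Σ (Poly≤ d) λ r → ∀ (t : ℝ) → eval p t ≈ c * eval w t + eval r t
  eliminate-leading {d} p w w≉0 = c , init r , λ t → begin
    eval p t                              ≈⟨ sum-cong-≋ {suc (suc d)} (λ i → *-congʳ {t ^ toℕ i} (x≈y+[x-y] (p i) (c * w i))) ⟩
    eval (λ i → c * w i + r i) t          ≈⟨ eval-+ (λ i → c * w i) r t ⟩
    eval (λ i → c * w i) t + eval r t     ≈⟨ +-cong (eval-scale c w t) (begin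
      eval r t                                   ≈⟨ eval-init-last r t ⟩
      eval (init r) t + r (fromℕ (suc d)) * t ^ suc d  ≈⟨ +-congˡ (trans (*-congʳ r-leading) (zeroˡ _)) ⟩
      eval (init r) t + 0#                       ≈⟨ +-identityʳ _ ⟩
      eval (init r) t                            ∎) ⟩
    c * eval w t + eval (init r) t        ∎
    where
    l = fromℕ (suc d)
    c = w l ⁻¹ * p l
    r : Poly≤ (suc d)
    r i = p i - c * w i
    r-leading : r l ≈ 0#
    r-leading = x≈y⇒x-y≈0 (sym (trans (*-comm c (w l)) (⁻¹*-cancel (p l) w≉0)))

  eval-*t : ∀ {d} (p : Poly≤ d) (t : ℝ) → eval (0# ∷ p) t ≈ t * eval p t
  eval-*t p t = trans (eval-∷ (0# ∷ p) t) (+-identityˡ _)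

  private
    count : ∀ {A : Set} {P : A → Set} (P? : ∀ x → Dec (P x)) {k} (f : Fin k → A) →
            fromNat (length (filter P? (tabulate f))) ≈ sum λ i → if does (P? (f i)) then 1# else 0#
    count P? {zero}  f = refl
    count P? {suc k} f with does (P? (f zero))
    ... | true  = +-congˡ (count P? (f ∘ suc))
    ... | false = trans (count P? (f ∘ suc)) (sym (+-identityˡ _))

  -- Turns the list length that defines `κ` into a double sum of indicators, which can be exchanged
  -- with other sums.
  count-pairs : ∀ {A B : Set} {P : A × B → Set} (P? : ∀ x → Dec (P x))
                {k l} (f : Fin k → A) (g : Fin l → B) →
                fromNat (length (filter P? (cartesianProduct (tabulate f) (tabulate g)))) ≈
                sum λ i → sum λ j → if does (P? (f i , g j)) then 1# else 0#
  count-pairs P? {zero}  f g = refl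
  count-pairs P? {suc k} f g = begin
    fromNat (length (filter P? (row ++ rest)))
      ≡⟨ ≡.cong (λ ys → fromNat {{𝓡}} (length ys)) (filter-++ P? row rest) ⟩
    fromNat (length (filter P? row ++ filter P? rest))
      ≡⟨ ≡.cong (λ k → fromNat {{𝓡}} k) (length-++ (filter P? row)) ⟩
    fromNat (length (filter P? row) ℕ.+ length (filter P? rest))
      ≈⟨ ×-homo-+ 1# (length (filter P? row)) _ ⟩
    fromNat (length (filter P? row)) + fromNat (length (filter P? rest))
      ≡⟨ ≡.cong (λ ys → fromNat {{𝓡}} (length (filter P? ys)) + fromNat (length (filter P? rest))) (map-tabulate g (f zero ,_)) ⟩
    fromNat (length (filter P? (tabulate (λ j → f zero , g j)))) + fromNat (length (filter P? rest))
      ≈⟨ +-cong (count P? (λ j → f zero , g j)) (count-pairs P? (f ∘ suc) g) ⟩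
    (sum λ i → sum λ j → if does (P? (f i , g j)) then 1# else 0#) ∎
    where
    row  = map (f zero ,_) (tabulate g)
    rest = cartesianProduct (tabulate (f ∘ suc)) (tabulate g)

  -- Matrices

  sum-combination : ∀ {k n} (c : Vector ℝ k) (f : Fin k → Vector ℝ n) →
                    sum (λ i → c ∙ (λ l → f l i)) ≈ c ∙ (λ l → sum (f l))
  sum-combination c f = trans (∑-comm (λ i l → c l * f l i))
    (sum-cong-≋ λ l → sym (*-distribˡ-sum (c l) (f l)))

  ∙-combination : ∀ {k n} (c : Vector ℝ k) (f : Fin k → Vector ℝ n) (g : Vector ℝ n) →
                  (λ i → c ∙ (λ l → f l i)) ∙ g ≈ c ∙ (λ l → f l ∙ g)
  ∙-combination c f g = trans
    (sum-cong-≋ λ i → trans (*-distribʳ-sum (g i) (λ l → c l * f l i))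
      (sum-cong-≋ λ l → *-assoc (c l) (f l i) (g i)))
    (sum-combination c (λ l i → f l i * g i))

  combination : ∀ {k n} → Vector ℝ k → (Fin k → Matrix n) → Matrix n
  combination c E i j = c ∙ (λ l → E l i j)

  module _ {n : ℕ} where

    ⟪_,_⟫ : Matrix n → Matrix n → ℝ
    ⟪ A , B ⟫ = sum λ i → A i ∙ B i

    ⟪⟫-cong : ∀ {A A′ B B′ : Matrix n} → A ≋ᴹ A′ → B ≋ᴹ B′ → ⟪ A , B ⟫ ≈ ⟪ A′ , B′ ⟫
    ⟪⟫-cong p q = sum-cong-≋ λ i → ∙-cong (p i) (q i)

    ⟪⟫-comm : ∀ (A B : Matrix n) → ⟪ A , B ⟫ ≈ ⟪ B , A ⟫
    ⟪⟫-comm A B = sum-cong-≋ λ i → ∙-comm (A i) (B i)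

    ⟪⟫-distribʳ : ∀ (A B C : Matrix n) → ⟪ A +ᴹ B , C ⟫ ≈ ⟪ A , C ⟫ + ⟪ B , C ⟫
    ⟪⟫-distribʳ A B C = trans (sum-cong-≋ λ i → ∙-distribʳ (A i) (B i) (C i))
      (∑-distrib-+ (λ i → A i ∙ C i) (λ i → B i ∙ C i))

    ⟪⟫-distribˡ : ∀ (A B C : Matrix n) → ⟪ C , A +ᴹ B ⟫ ≈ ⟪ C , A ⟫ + ⟪ C , B ⟫
    ⟪⟫-distribˡ A B C = trans (⟪⟫-comm C (A +ᴹ B))
      (trans (⟪⟫-distribʳ A B C) (+-cong (⟪⟫-comm A C) (⟪⟫-comm B C)))

    ⟪⟫-scaleˡ : ∀ c (A B : Matrix n) → ⟪ scale c A , B ⟫ ≈ c * ⟪ A , B ⟫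
    ⟪⟫-scaleˡ c A B = trans (sum-cong-≋ λ i → ∙-scaleˡ c (A i) (B i))
      (sym (*-distribˡ-sum c (λ i → A i ∙ B i)))

    ⟪⟫-scaleʳ : ∀ c (A B : Matrix n) → ⟪ A , scale c B ⟫ ≈ c * ⟪ A , B ⟫
    ⟪⟫-scaleʳ c A B = trans (⟪⟫-comm A (scale c B)) (trans (⟪⟫-scaleˡ c B A) (*-congˡ (⟪⟫-comm B A)))

    ⟪⟫-combinationˡ : ∀ {k} (c : Vector ℝ k) (E : Fin k → Matrix n) (B : Matrix n) →
                      ⟪ combination c E , B ⟫ ≈ c ∙ (λ l → ⟪ E l , B ⟫)
    ⟪⟫-combinationˡ c E B = trans (sum-cong-≋ λ i → ∙-combination c (λ l → E l i) (B i))
      (sum-combination c (λ l i → E l i ∙ B i))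

    ⟪⟫-combinationʳ : ∀ {k} (c : Vector ℝ k) (E : Fin k → Matrix n) (B : Matrix n) →
                      ⟪ B , combination c E ⟫ ≈ c ∙ (λ l → ⟪ B , E l ⟫)
    ⟪⟫-combinationʳ c E B = trans (⟪⟫-comm B (combination c E))
      (trans (⟪⟫-combinationˡ c E B) (sum-cong-≋ λ l → *-congˡ (⟪⟫-comm (E l) B)))

    ⟪⟫-columns : ∀ (A B : Matrix n) → ⟪ A , B ⟫ ≈ sum λ j → (λ i → A i j) ∙ (λ i → B i j)
    ⟪⟫-columns A B = ∑-comm (λ i j → A i j * B i j)

    ⟪⟫-nonNegative : ∀ (A : Matrix n) → 0# ≤ ⟪ A , A ⟫
    ⟪⟫-nonNegative A = sum-nonNegative λ i → sum-nonNegative λ j → 0≤x*x (A i j)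

    ⟪⟫-definite : ∀ (A : Matrix n) → ⟪ A , A ⟫ ≈ 0# → A ≋ᴹ 0ᴹ
    ⟪⟫-definite A e i = ∙-definite (A i)
      (sum-nonNegative≈0 (λ i → sum-nonNegative λ j → 0≤x*x (A i j)) e i)

    ⟪⟫-identity : ∀ (A : Matrix n) → ⟪ A , δ ⟫ ≈ trace A
    ⟪⟫-identity A = sum-cong-≋ λ i → ∙-δ i (A i)

    infixl 6 _-ᴹ_
    _-ᴹ_ : Matrix n → Matrix n → Matrix n
    (A -ᴹ B) i j = A i j - B i j

    A+[B-A]≋B : ∀ (A B : Matrix n) → A +ᴹ (B -ᴹ A) ≋ᴹ B
    A+[B-A]≋B A B i j = sym (x≈y+[x-y] (B i j) (A i j))

    -- The hypothesis amounts to B - A being orthogonal to A.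
    pythagoras : ∀ (A B : Matrix n) → ⟪ A , B ⟫ ≈ ⟪ A , A ⟫ →
                 ⟪ B , B ⟫ ≈ ⟪ A , A ⟫ + ⟪ B -ᴹ A , B -ᴹ A ⟫
    pythagoras A B e = begin
      ⟪ B , B ⟫                                   ≈⟨ ⟪⟫-cong (A+[B-A]≋B A B) (A+[B-A]≋B A B) ⟨
      ⟪ A +ᴹ D , A +ᴹ D ⟫                         ≈⟨ ⟪⟫-distribʳ A D (A +ᴹ D) ⟩
      ⟪ A , A +ᴹ D ⟫ + ⟪ D , A +ᴹ D ⟫             ≈⟨ +-cong (trans (⟪⟫-cong {A} (λ _ _ → refl) (A+[B-A]≋B A B)) e)
                                                       (⟪⟫-distribˡ A D D) ⟩
      ⟪ A , A ⟫ + (⟪ D , A ⟫ + ⟪ D , D ⟫)         ≈⟨ +-congˡ (+-congʳ ⟪D,A⟫≈0) ⟩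
      ⟪ A , A ⟫ + (0# + ⟪ D , D ⟫)                ≈⟨ +-congˡ (+-identityˡ _) ⟩
      ⟪ A , A ⟫ + ⟪ D , D ⟫                       ∎
      where
      D = B -ᴹ A
      ⟪D,A⟫≈0 : ⟪ D , A ⟫ ≈ 0#
      ⟪D,A⟫≈0 = +-cancelˡ ⟪ A , A ⟫ _ _ (begin
        ⟪ A , A ⟫ + ⟪ D , A ⟫   ≈⟨ ⟪⟫-distribʳ A D A ⟨
        ⟪ A +ᴹ D , A ⟫          ≈⟨ ⟪⟫-cong {B = A} (A+[B-A]≋B A B) (λ _ _ → refl) ⟩
        ⟪ B , A ⟫               ≈⟨ ⟪⟫-comm B A ⟩
        ⟪ A , B ⟫               ≈⟨ e ⟩
        ⟪ A , A ⟫               ≈⟨ +-identityʳ _ ⟨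
        ⟪ A , A ⟫ + 0#          ∎)

    *ᴹ-cong : ∀ {A A′ B B′ : Matrix n} → A ≋ᴹ A′ → B ≋ᴹ B′ → A *ᴹ B ≋ᴹ A′ *ᴹ B′
    *ᴹ-cong p q i j = ∙-cong (p i) (λ k → q k j)

    *ᴹ-combinationˡ : ∀ {k} (c : Vector ℝ k) (E : Fin k → Matrix n) (B : Matrix n) →
                      combination c E *ᴹ B ≋ᴹ combination c (λ l → E l *ᴹ B)
    *ᴹ-combinationˡ c E B i j = ∙-combination c (λ l → E l i) (λ k → B k j)

    *ᴹ-combinationʳ : ∀ {k} (c : Vector ℝ k) (E : Fin k → Matrix n) (B : Matrix n) →
                      B *ᴹ combination c E ≋ᴹ combination c (λ l → B *ᴹ E l)
    *ᴹ-combinationʳ c E B i j = begin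
      B i ∙ (λ k → combination c E k j)          ≈⟨ ∙-comm (B i) _ ⟩
      (λ k → combination c E k j) ∙ B i          ≈⟨ ∙-combination c (λ l k → E l k j) (B i) ⟩
      c ∙ (λ l → (λ k → E l k j) ∙ B i)          ≈⟨ sum-cong-≋ (λ l → *-congˡ (∙-comm (λ k → E l k j) (B i))) ⟩
      c ∙ (λ l → (B *ᴹ E l) i j)                 ∎

  -- Orthogonal projections

  -- The matrix is given only through `F f` lying in W and f - `F f` being orthogonal to W;
  -- symmetry, idempotence and tr F = ‖F‖² are derived. Orthogonality is for `∙`, which is n times
  -- `inner`.
  module OrthogonalProjection {n : ℕ} (W : Vector ℝ n → Set)
    (W-resp : ∀ {f g : Vector ℝ n} → (∀ i → f i ≈ g i) → W f → W g)
    (W-sub : ∀ {f g : Vector ℝ n} → W f → W g → W (λ i → f i - g i))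
    (F : Matrix n) (F∈W : ∀ (f : Vector ℝ n) → W (λ i → F i ∙ f))
    (F-orth : ∀ (f g : Vector ℝ n) → W g → (λ i → f i - F i ∙ f) ∙ g ≈ 0#) where

    private
      _⟂W : Vector ℝ n → Set
      f ⟂W = ∀ g → W g → f ∙ g ≈ 0#

    F-∙ : ∀ (f g : Vector ℝ n) → W g → f ∙ g ≈ (λ i → F i ∙ f) ∙ g
    F-∙ f g w = trans (∙-split f (λ i → F i ∙ f) g) (trans (+-congˡ (F-orth f g w)) (+-identityʳ _))

    -- The image `F f` lies in W, so 0 = f ∙ `F f` = `F f` ∙ `F f`.
    F-kills : ∀ (f : Vector ℝ n) → f ⟂W → ∀ i → F i ∙ f ≈ 0#
    F-kills f f⟂W = ∙-definite _ (trans (sym (F-∙ f _ (F∈W f))) (f⟂W _ (F∈W f)))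

    F-fixes : ∀ (f : Vector ℝ n) → W f → ∀ i → F i ∙ f ≈ f i
    F-fixes f w i = sym (x-y≈0⇒x≈y
      (∙-definite (λ i → f i - F i ∙ f) (F-orth f _ (W-sub w (F∈W f))) i))

    F-column : ∀ j → W (λ i → F i j)
    F-column j = W-resp (λ i → ∙-δ j (F i)) (F∈W (δ j))

    private
      -- Entrywise this is F = Fᵀ F, the common source of symmetry and of the norm formula. It is
      -- the projection property applied to a basis vector and a column of F.
      columns : ∀ i j → F i j ≈ (λ k → F k i) ∙ (λ k → F k j)
      columns i j = begin
        F i j                                       ≈⟨ δ-∙ i (λ k → F k j) ⟨
        δ i ∙ (λ k → F k j)                         ≈⟨ F-∙ (δ i) _ (F-column j) ⟩
        (λ k → F k ∙ δ i) ∙ (λ k → F k j)           ≈⟨ ∙-cong (λ k → ∙-δ i (F k)) (λ _ → refl) ⟩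
        (λ k → F k i) ∙ (λ k → F k j)               ∎

    F-symmetric : ∀ i j → F i j ≈ F j i
    F-symmetric i j = trans (columns i j) (trans (∙-comm _ (λ k → F k j)) (sym (columns j i)))

    F-idempotent : F *ᴹ F ≋ᴹ F
    F-idempotent i j = F-fixes (λ k → F k j) (F-column j) i

    F-norm : ⟪ F , F ⟫ ≈ trace F
    F-norm = trans (⟪⟫-columns F F) (sum-cong-≋ λ j → sym (columns j j))

    F-perpendicular : ∀ (M : Matrix n) → (∀ j → (λ i → M i j) ⟂W) → ⟪ F , M ⟫ ≈ 0#
    F-perpendicular M ⟂ = trans (⟪⟫-columns F M)
      (sum-zero λ j → trans (∙-comm (λ i → F i j) _) (⟂ j _ (F-column j)))

  -- Spaces of polynomial functions

  module _ {m n : ℕ} (X : Fin n → Vector ℝ m) where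

    module _ (P : Vector ℝ n → Set) where

      Span-resp : ∀ {f g : Vector ℝ n} → (∀ i → f i ≈ g i) → Span X P f → Span X P g
      Span-resp e (N , c , h , p , eq) = N , c , h , p , λ i → trans (sym (e i)) (eq i)

      Span-cons : ∀ c {f g : Vector ℝ n} → P f → Span X P g → Span X P (λ i → c * f i + g i)
      Span-cons c {f} pf (N , cs , h , p , eq) = suc N , c ∷ cs , f ∷ h ,
        (λ { zero → pf ; (suc l) → p l }) , λ i → +-congˡ (eq i)

      Span-incl : ∀ {f : Vector ℝ n} → P f → Span X P f
      Span-incl {f} pf = Span-resp (λ i → trans (+-identityʳ _) (*-identityˡ (f i)))
        (Span-cons 1# pf (0 , (λ ()) , (λ ()) , (λ ()) , λ i → refl))

      Span-+ : ∀ {f g : Vector ℝ n} → Span X P f → Span X P g → Span X P (λ i → f i + g i)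
      Span-+ (N , c , h , p , eq) sg = go N c h p eq sg
        where
        go : ∀ N (c : Vector ℝ N) (h : Fin N → Vector ℝ n) → (∀ l → P (h l)) →
             ∀ {f g : Vector ℝ n} → (∀ i → f i ≈ c ∙ (λ l → h l i)) →
             Span X P g → Span X P (λ i → f i + g i)
        go zero    c h p eq sg = Span-resp (λ i → sym (trans (+-congʳ (eq i)) (+-identityˡ _))) sg
        go (suc N) c h p eq sg = Span-resp (λ i → sym (trans (+-congʳ (eq i)) (+-assoc _ _ _)))
          (Span-cons (c zero) (p zero) (go N (tail c) (tail h) (λ l → p (suc l)) (λ i → refl) sg))

      Span-scale : ∀ c {f : Vector ℝ n} → Span X P f → Span X P (λ i → c * f i)
      Span-scale c (N , cs , h , p , eq) = N , (λ l → c * cs l) , h , p , λ i →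
        trans (*-congˡ (eq i)) (sym (∙-scaleˡ c cs (λ l → h l i)))

    -- `Generator k` spans `Pol (suc k)`. It names the generating sets that are anonymous in the
    -- definition of `Pol`, so that the lemmas on `Span` apply in every positive degree.
    Generator : ℕ → Vector ℝ n → Set
    Generator zero    f = ∃[ a ] Σ (Poly≤ 1) λ p → ∀ i → f i ≈ ζ X a p i
    Generator (suc k) h = Σ (Vector ℝ n) λ f → Σ (Vector ℝ n) λ g → Pol₁ X f × Pol X (suc k) g × (∀ i → h i ≈ f i * g i)

    Pol-resp : ∀ k {f g : Vector ℝ n} → (∀ i → f i ≈ g i) → Pol X k f → Pol X k g
    Pol-resp 0             e (c , p) = c , λ i → trans (sym (e i)) (p i)
    Pol-resp 1             e p       = Span-resp (Generator 0) e p
    Pol-resp (suc (suc k)) e p       = Span-resp (Generator (suc k)) e p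

    Pol-+ : ∀ k {f g : Vector ℝ n} → Pol X k f → Pol X k g → Pol X k (λ i → f i + g i)
    Pol-+ 0             (c , p) (d , r) = c + d , λ i → +-cong (p i) (r i)
    Pol-+ 1             p       r       = Span-+ (Generator 0) p r
    Pol-+ (suc (suc k)) p       r       = Span-+ (Generator (suc k)) p r

    Pol-scale : ∀ k c {f : Vector ℝ n} → Pol X k f → Pol X k (λ i → c * f i)
    Pol-scale 0             c (d , p) = c * d , λ i → *-congˡ (p i)
    Pol-scale 1             c p       = Span-scale (Generator 0) c p
    Pol-scale (suc (suc k)) c p       = Span-scale (Generator (suc k)) c p

    Pol-sub : ∀ k {f g : Vector ℝ n} → Pol X k f → Pol X k g → Pol X k (λ i → f i - g i)
    Pol-sub k {g = g} p r =
      Pol-resp k (λ i → +-congˡ (-1*x≈-x (g i))) (Pol-+ k p (Pol-scale k (- 1#) r))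

    Pol-* : ∀ k {f g : Vector ℝ n} → Pol X 1 f → Pol X k g → Pol X (suc k) (λ i → f i * g i)
    Pol-* 0       {f} p (c , r) =
      Pol-resp 1 (λ i → trans (*-comm c (f i)) (*-congˡ (sym (r i)))) (Pol-scale 1 c p)
    Pol-* (suc k) {f} {g} p r = Span-incl (Generator (suc k)) (f , g , p , r , λ i → refl)

    Harm-resp : ∀ k {f g : Vector ℝ n} → (∀ i → f i ≈ g i) → Harm X k f → Harm X k g
    Harm-resp zero    e p       = Pol-resp 0 e p
    Harm-resp (suc k) e (p , o) = Pol-resp (suc k) e p ,
      λ h ph → trans (*-congˡ (sum-cong-≋ λ i → *-congʳ (sym (e i)))) (o h ph)

    Harm⇒Pol : ∀ k {f : Vector ℝ n} → Harm X k f → Pol X k f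
    Harm⇒Pol zero    p = p
    Harm⇒Pol (suc k) p = proj₁ p

    -- A point is needed to include each `Pol k` in the next: the constant 1 enters `Pol 1` as ζ of
    -- a constant polynomial at some point. It also makes n invertible.
    module _ (a₀ : Fin n) where

      n≉0 : ¬ fromNat n ≈ 0#
      n≉0 = fromNat-nonzero (positive a₀)
        where
        positive : ∀ {k} → Fin k → 1 ℕ.≤ k
        positive {suc k} _ = s≤s z≤n

      Pol₁-constant : ∀ (c : ℝ) → Pol X 1 (λ _ → c)
      Pol₁-constant c = Span-incl (Generator 0) (a₀ , p , λ i → sym (trans (eval-∷ p (X a₀ ∙ X i))
          (trans (+-congˡ (trans (*-congˡ (eval-constant (tail p) (X a₀ ∙ X i))) (zeroʳ _))) (+-identityʳ c))))
        where
        p : Poly≤ 1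
        p = c ∷ λ _ → 0#

      Pol₁-linear : ∀ a → Pol X 1 (λ i → X a ∙ X i)
      Pol₁-linear a = Span-incl (Generator 0) (a , p , λ i → sym (trans (eval-∷ p (X a ∙ X i))
          (trans (+-identityˡ _) (trans (*-congˡ (eval-constant (tail p) (X a ∙ X i))) (*-identityʳ _)))))
        where
        p : Poly≤ 1
        p = 0# ∷ λ _ → 1#

      Pol-suc : ∀ k {f : Vector ℝ n} → Pol X k f → Pol X (suc k) f
      Pol-suc k {f} p = Pol-resp (suc k) (λ i → *-identityˡ (f i)) (Pol-* k (Pol₁-constant 1#) p)

      Pol-mono′ : ∀ {k l} {f : Vector ℝ n} → k ℕ.≤′ l → Pol X k f → Pol X l f
      Pol-mono′ (ℕ.≤′-reflexive ≡.refl) p = p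
      Pol-mono′ {l = suc l} {f} (ℕ.≤′-step k≤l) p = Pol-suc l {f} (Pol-mono′ {f = f} k≤l p)

      Pol-constant : ∀ k (c : ℝ) → Pol X k (λ _ → c)
      Pol-constant zero    c = c , λ _ → refl
      Pol-constant (suc k) c = Pol-suc k (Pol-constant k c)

      -- In Horner form, each multiplication by t is multiplication by the function x ↦ a · x of
      -- degree one.
      ζ∈Pol : ∀ {d} a (p : Poly≤ d) → Pol X d (ζ X a p)
      ζ∈Pol {zero}  a p = p zero , λ i → eval-constant p (X a ∙ X i)
      ζ∈Pol {suc d} a p = Pol-resp (suc d) (λ i → sym (eval-∷ p (X a ∙ X i)))
        (Pol-+ (suc d) (Pol-constant (suc d) (p zero)) (Pol-* d (Pol₁-linear a) (ζ∈Pol a (tail p))))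

      inner≈0⇒∙≈0 : ∀ (f g : Vector ℝ n) → inner X f g ≈ 0# → f ∙ g ≈ 0#
      inner≈0⇒∙≈0 f g = *-cancel-0 (⁻¹-nonzero n≉0)

      ∙≈0⇒inner≈0 : ∀ (f g : Vector ℝ n) → f ∙ g ≈ 0# → inner X f g ≈ 0#
      ∙≈0⇒inner≈0 f g e = trans (*-congˡ e) (zeroʳ _)

      Harm-sub : ∀ k {f g : Vector ℝ n} → Harm X k f → Harm X k g → Harm X k (λ i → f i - g i)
      Harm-sub zero    p       r       = Pol-sub 0 p r
      Harm-sub (suc k) {f} {g} (p , o) (r , o′) = Pol-sub (suc k) p r , λ h ph → ∙≈0⇒inner≈0 _ h (begin
        (λ i → f i - g i) ∙ h               ≈⟨ +-identityˡ _ ⟨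
        0# + (λ i → f i - g i) ∙ h          ≈⟨ +-congʳ (inner≈0⇒∙≈0 g h (o′ h ph)) ⟨
        g ∙ h + (λ i → f i - g i) ∙ h       ≈⟨ ∙-split f g h ⟨
        f ∙ h                               ≈⟨ inner≈0⇒∙≈0 f h (o h ph) ⟩
        0#                                  ∎)

      Pol⟂Harm : ∀ {k l} {f g : Vector ℝ n} → k ℕ.< l → Pol X k f → Harm X l g → f ∙ g ≈ 0#
      Pol⟂Harm {k} {suc l} {f} {g} (s≤s k≤l) p (_ , o) =
        trans (∙-comm f g) (inner≈0⇒∙≈0 g f (o f (Pol-mono′ (≤⇒≤′ k≤l) p)))

  -- Spherical 2-designs

  average-cong : ∀ {n} {f g : Vector ℝ n} → (∀ i → f i ≈ g i) → average f ≈ average g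
  average-cong e = *-congˡ (sum-cong-≋ e)

  -- For n = 0 the average of the constant 1 is an empty sum times 0⁻¹, hence 0 whatever 0⁻¹ is,
  -- whereas its average over the sphere is 1.
  design-nonempty : ∀ {m n} (X : Fin n → Vector ℝ m) → IsSpherical2Design X → Fin n
  design-nonempty {m} {zero}  X design = ⊥-elim (0≉1 (begin
    0#               ≈⟨ zeroʳ _ ⟨
    0# ⁻¹ * 0#       ≈⟨ design one ⟩
    1# + sum {m} (λ _ → 0#)  ≈⟨ +-congˡ (sum-zero {m} (λ _ → refl)) ⟩
    1# + 0#          ≈⟨ +-identityʳ 1# ⟩
    1#               ∎))
    where
    one : MultiPoly≤2 m
    one = record { constant = 1# ; linear = λ _ → 0# ; quadratic = λ _ _ → 0# }
  design-nonempty {m} {suc n} X design = zero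

  module _ {m n : ℕ} (X : Fin n → Vector ℝ m) (design : IsSpherical2Design X) where

    private
      a₀ = design-nonempty X design
      N≉0 = n≉0 X a₀

      average⇒sum : ∀ {f : Vector ℝ n} {c} → average f ≈ c → sum f ≈ fromNat n * c
      average⇒sum {f} e = trans (sym (⁻¹*-cancel (sum f) N≉0)) (*-congˡ e)

    design₁ : ∀ a → sum (λ i → X a ∙ X i) ≈ 0#
    design₁ a = trans (average⇒sum (begin
      average (λ i → X a ∙ X i)                   ≈⟨ average-cong (λ i → evaluated (X i)) ⟨
      average (λ i → MultiPoly≤2.evalAt p (X i))  ≈⟨ design p ⟩
      0# + sum {m} (λ _ → 0#)                     ≈⟨ trans (+-identityˡ _) (sum-zero {m} (λ _ → refl)) ⟩
      0#                                          ∎)) (zeroʳ _)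
      where
      p : MultiPoly≤2 m
      p = record { constant = 0# ; linear = X a ; quadratic = λ _ _ → 0# }
      evaluated : ∀ (t : Vector ℝ m) → MultiPoly≤2.evalAt p t ≈ X a ∙ t
      evaluated t = trans (+-cong (+-identityˡ _)
        (sum-zero λ i → sum-zero λ j → zeroˡ (t i * t j))) (+-identityʳ _)

    -- The test polynomial (a · t)(b · t) has coefficient matrix (a_i b_j), and its average over the
    -- sphere is the trace a · b of that matrix.
    design₂ : ∀ a b → sum (λ i → (X a ∙ X i) * (X b ∙ X i)) ≈ fromNat n * (X a ∙ X b)
    design₂ a b = average⇒sum (begin
      average (λ i → (X a ∙ X i) * (X b ∙ X i))   ≈⟨ average-cong (λ i → evaluated (X i)) ⟨
      average (λ i → MultiPoly≤2.evalAt p (X i))  ≈⟨ design p ⟩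
      0# + X a ∙ X b                              ≈⟨ +-identityˡ _ ⟩
      X a ∙ X b                                   ∎)
      where
      p : MultiPoly≤2 m
      p = record { constant = 0# ; linear = λ _ → 0# ; quadratic = λ i j → X a i * X b j }
      evaluated : ∀ (t : Vector ℝ m) → MultiPoly≤2.evalAt p t ≈ (X a ∙ t) * (X b ∙ t)
      evaluated t = begin
        0# + sum (λ i → 0# * t i) + sum (λ i → sum λ j → X a i * X b j * (t i * t j))
          ≈⟨ +-congʳ (trans (+-identityˡ _) (sum-zero λ i → zeroˡ (t i))) ⟩
        0# + sum (λ i → sum λ j → X a i * X b j * (t i * t j))
          ≈⟨ +-identityˡ _ ⟩
        sum (λ i → sum λ j → X a i * X b j * (t i * t j))
          ≈⟨ sum-cong-≋ (λ i → trans
               (sum-cong-≋ λ j → solve 4 (λ x y t u → x :* y :* (t :* u) := x :* t :* (y :* u)) refl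
                 (X a i) (X b j) (t i) (t j))
               (sym (*-distribˡ-sum (X a i * t i) (λ j → X b j * t j)))) ⟩
        sum (λ i → X a i * t i * (X b ∙ t))
          ≈⟨ *-distribʳ-sum (X b ∙ t) (λ i → X a i * t i) ⟨
        (X a ∙ t) * (X b ∙ t) ∎

    -- For a 2-design the normalised Gram matrix is the orthogonal projection
    -- onto Harm₁.
    gram : Matrix n
    gram i j = fromNat n ⁻¹ * (X i ∙ X j)

    gram-symmetric : ∀ i j → gram i j ≈ gram j i
    gram-symmetric i j = *-congˡ (∙-comm (X i) (X j))

    gram-row-sum : ∀ i → sum (gram i) ≈ 0#
    gram-row-sum i = trans (sym (*-distribˡ-sum _ (λ j → X i ∙ X j)))
      (trans (*-congˡ (design₁ i)) (zeroʳ _))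

    gram-linear : ∀ i a → gram i ∙ (λ j → X a ∙ X j) ≈ X a ∙ X i
    gram-linear i a = begin
      gram i ∙ (λ j → X a ∙ X j)              ≈⟨ ∙-scaleˡ N⁻¹ (λ j → X i ∙ X j) (λ j → X a ∙ X j) ⟩
      N⁻¹ * sum (λ j → (X i ∙ X j) * (X a ∙ X j))  ≈⟨ *-congˡ (design₂ i a) ⟩
      N⁻¹ * (fromNat n * (X i ∙ X a))         ≈⟨ solve 3 (λ x y z → x :* (y :* z) := y :* (x :* z)) refl N⁻¹ (fromNat n) _ ⟩
      fromNat n * (N⁻¹ * (X i ∙ X a))         ≈⟨ ⁻¹*-cancel _ N≉0 ⟩
      X i ∙ X a                               ≈⟨ ∙-comm (X i) (X a) ⟩
      X a ∙ X i                               ∎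
      where
      N⁻¹ = fromNat n ⁻¹

    gram-constant : ∀ i (c : ℝ) → gram i ∙ (λ _ → c) ≈ 0#
    gram-constant i c = trans (sym (*-distribʳ-sum c (gram i)))
      (trans (*-congʳ (gram-row-sum i)) (zeroˡ c))

    gram-column∈Harm₁ : ∀ j → Harm X 1 (λ i → gram i j)
    gram-column∈Harm₁ j =
      Pol-resp X 1 (λ i → *-congˡ (∙-comm (X j) (X i)))
        (Pol-scale X 1 (fromNat n ⁻¹) (Pol₁-linear X a₀ j)) ,
      λ g (c , g≈c) → ∙≈0 g (trans (∙-cong (λ i → gram-symmetric i j) g≈c) (gram-constant j c))
      where
      ∙≈0 : ∀ (g : Vector ℝ n) → (λ i → gram i j) ∙ g ≈ 0# → inner X (λ i → gram i j) g ≈ 0#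
      ∙≈0 = ∙≈0⇒inner≈0 X a₀ (λ i → gram i j)

    -- Each generator is an affine function of a · x; `gram` fixes its linear part and kills its
    -- constant part, so only constants are lost.
    gram-Pol₁ : ∀ (f : Vector ℝ n) → Pol X 1 f → Σ ℝ λ e → ∀ i → f i ≈ e + gram i ∙ f
    gram-Pol₁ f (k , c , g , gens , eq) = c ∙ e , λ i → begin
      f i                                            ≈⟨ eq i ⟩
      c ∙ (λ l → g l i)                              ≈⟨ ∙-cong {f = c} (λ _ → refl) (λ l → generator l i) ⟩
      c ∙ (λ l → e l + gram i ∙ g l)                 ≈⟨ ∙-distribˡ e (λ l → gram i ∙ g l) c ⟩
      c ∙ e + c ∙ (λ l → gram i ∙ g l)               ≈⟨ +-congˡ (∙-cong {f = c} (λ _ → refl) (λ l → ∙-comm (gram i) (g l))) ⟩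
      c ∙ e + c ∙ (λ l → g l ∙ gram i)               ≈⟨ +-congˡ (∙-combination c g (gram i)) ⟨
      c ∙ e + (λ j → c ∙ (λ l → g l j)) ∙ gram i     ≈⟨ +-congˡ (trans (∙-comm _ (gram i)) (∙-cong {f = gram i} (λ _ → refl) (λ j → sym (eq j)))) ⟩
      c ∙ e + gram i ∙ f                             ∎
      where
      e : Vector ℝ k
      e l = proj₁ (proj₂ (gens l)) zero
      generator : ∀ l i → g l i ≈ e l + gram i ∙ g l
      generator l i = begin
        g l i                                        ≈⟨ affine i ⟩
        e l + p₁ * (X a ∙ X i)                       ≈⟨ +-congˡ (*-congˡ (gram-linear i a)) ⟨
        e l + p₁ * (gram i ∙ (λ j → X a ∙ X j))      ≈⟨ +-congˡ (∙-scaleʳ p₁ (gram i) (λ j → X a ∙ X j)) ⟨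
        e l + gram i ∙ (λ j → p₁ * (X a ∙ X j))      ≈⟨ +-congˡ (trans (+-congʳ (gram-constant i (e l))) (+-identityˡ _)) ⟨
        e l + (gram i ∙ (λ _ → e l) + gram i ∙ (λ j → p₁ * (X a ∙ X j)))
                                                     ≈⟨ +-congˡ (∙-distribˡ (λ _ → e l) (λ j → p₁ * (X a ∙ X j)) (gram i)) ⟨
        e l + gram i ∙ (λ j → e l + p₁ * (X a ∙ X j)) ≈⟨ +-congˡ (∙-cong {f = gram i} (λ _ → refl) affine) ⟨
        e l + gram i ∙ g l                           ∎
        where
        a = proj₁ (gens l)
        p = proj₁ (proj₂ (gens l))
        p₁ = p (suc zero)
        affine : ∀ j → g l j ≈ e l + p₁ * (X a ∙ X j)
        affine j = trans (proj₂ (proj₂ (gens l)) j) (trans (eval-∷ p (X a ∙ X j))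
          (+-congˡ (trans (*-congˡ (eval-constant (tail p) (X a ∙ X j))) (*-comm _ _))))

    -- Summing the identity of `gram-Pol₁` over X gives n e = 0, because both f and the image of
    -- `gram` are orthogonal to constants.
    gram-fixes-Harm₁ : ∀ (f : Vector ℝ n) → Harm X 1 f → ∀ i → gram i ∙ f ≈ f i
    gram-fixes-Harm₁ f (pol , ⟂) i = sym (trans (eq i) (trans (+-congʳ e≈0) (+-identityˡ _)))
      where
      e = proj₁ (gram-Pol₁ f pol)
      eq = proj₂ (gram-Pol₁ f pol)
      sum-f : sum f ≈ 0#
      sum-f = trans (sum-cong-≋ λ i → sym (*-identityʳ (f i)))
        (inner≈0⇒∙≈0 X a₀ f (λ _ → 1#) (⟂ (λ _ → 1#) (1# , λ _ → refl)))
      sum-gram : sum (λ i → gram i ∙ f) ≈ 0#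
      sum-gram = trans (∑-comm (λ i j → gram i j * f j)) (sum-zero λ j →
        trans (sym (*-distribʳ-sum (f j) (λ i → gram i j)))
          (trans (*-congʳ (trans (sum-cong-≋ λ i → gram-symmetric i j) (gram-row-sum j))) (zeroˡ _)))
      e≈0 : e ≈ 0#
      e≈0 = *-cancel-0 N≉0 (begin
        fromNat n * e                            ≈⟨ sum-const {n} e ⟨
        sum {n} (λ _ → e)                        ≈⟨ +-identityʳ _ ⟨
        sum {n} (λ _ → e) + 0#                   ≈⟨ +-congˡ sum-gram ⟨
        sum {n} (λ _ → e) + sum (λ i → gram i ∙ f)  ≈⟨ ∑-distrib-+ (λ _ → e) (λ i → gram i ∙ f) ⟨
        sum (λ i → e + gram i ∙ f)               ≈⟨ sum-cong-≋ eq ⟨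
        sum f                                    ≈⟨ sum-f ⟩
        0#                                       ∎)

  -- Inner-product relations and the matrices of functions on A′(X)

  module Relations {m n s : ℕ} (X : Fin n → Vector ℝ m) (distinct : AreDistinct X)
    (sphere : OnSphere X) (a₀ : Fin n) (α : Vector ℝ s) (distances : IsDistanceSet X s α) where

    open IsDistanceSet distances

    -- On the sphere, x · y = m gives |x - y|² = m - 2m + m = 0. Hence m is not in A(X), and A′(X)
    -- has s + 1 elements.
    R₀⇒≡ : ∀ {i j} → R X α zero i j → i ≡ j
    R₀⇒≡ {i} {j} e = distinct i j λ l → x-y≈0⇒x≈y (∙-definite d d∙d≈0 l)
      where
      d : Vector ℝ m
      d l = X i l - X j l
      d∙ : ∀ (w : Vector ℝ m) → X i ∙ w ≈ X j ∙ w → d ∙ w ≈ 0#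
      d∙ w e = +-cancelˡ (X j ∙ w) _ _
        (trans (sym (∙-split (X i) (X j) w)) (trans e (sym (+-identityʳ _))))
      d∙d≈0 : d ∙ d ≈ 0#
      d∙d≈0 = d∙ d (trans (∙-comm (X i) d) (trans
        (trans (d∙ (X i) (trans (sphere i) (sym (trans (∙-comm (X j) (X i)) e))))
          (sym (d∙ (X j) (trans e (sym (sphere j))))))
        (∙-comm d (X j))))

    A′-distinct : Distinct (A′ X α)
    A′-distinct zero    zero    e = ≡.refl
    A′-distinct zero    (suc l) e = let (i , j , i≢j , e′) = sound l in
      contradiction (R₀⇒≡ (sym (trans e e′))) i≢j
    A′-distinct (suc k) zero    e = let (i , j , i≢j , e′) = sound k in
      contradiction (R₀⇒≡ (trans (sym e′) e)) i≢j
    A′-distinct (suc k) (suc l) e = ≡.cong suc (injective k l e)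

    R-unique : ∀ {k l i j} → R X α k i j → R X α l i j → k ≡ l
    R-unique {k} {l} p r = A′-distinct k l (trans (sym p) r)

    R-covering : ∀ i j → ∃[ k ] R X α k i j
    R-covering i j with i Fin.≟ j
    ... | yes ≡.refl = zero , sphere i
    ... | no  i≢j    = let (k , e) = complete _ (i , j , i≢j , refl) in suc k , e

    R-nonempty : ∀ k → ∃[ i ] ∃[ j ] R X α k i j
    R-nonempty zero    = a₀ , a₀ , sphere a₀
    R-nonempty (suc k) = let (i , j , _ , e) = sound k in i , j , sym e

    class : Fin n → Fin n → Fin (suc s)
    class i j = proj₁ (R-covering i j)

    class-R : ∀ i j → X i ∙ X j ≈ A′ X α (class i j)
    class-R i j = proj₂ (R-covering i j)

    class-unique : ∀ {k i j} → R X α k i j → class i j ≡ k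
    class-unique {k} {i} {j} r = R-unique (class-R i j) r

    δ-class : ∀ i j → δ i j ≈ δ zero (class i j)
    δ-class i j with i Fin.≟ j
    ... | yes ≡.refl = δ-diagonal i
    ... | no  i≢j    = δ-offDiagonal i≢j

    adjacency≈δ : ∀ k i j → adjacency (R X α) (R? X α) k i j ≈ δ (class i j) k
    adjacency≈δ k i j with X i ∙ X j ≟ A′ X α k
    ... | yes r  with ≡.refl ← class-unique {k} {i} {j} r = sym (δ-diagonal k)
    ... | no  ¬r = sym (δ-offDiagonal {i = class i j} {k} λ { ≡.refl → ¬r (class-R i j) })

    ∙-adjacency : ∀ (c : Vector ℝ (suc s)) i j →
                  c ∙ (λ k → adjacency (R X α) (R? X α) k i j) ≈ c (class i j)
    ∙-adjacency c i j = trans (∙-cong {f = c} (λ _ → refl) (λ k → adjacency≈δ k i j))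
      (∙-δ (class i j) c)

    N : ℝ
    N = fromNat n

    N≉0 : ¬ N ≈ 0#
    N≉0 = n≉0 X a₀

    N*N⁻¹ : ∀ (x : ℝ) → N * (N ⁻¹ * x) ≈ x
    N*N⁻¹ x = ⁻¹*-cancel x N≉0

    N⁻¹*N : ∀ (x : ℝ) → N ⁻¹ * (N * x) ≈ x
    N⁻¹*N x = trans (solve 3 (λ x y z → x :* (y :* z) := y :* (x :* z)) refl (N ⁻¹) N x) (N*N⁻¹ x)

    -- The normalisation makes the Hilbert–Schmidt inner product of ⟦ p ⟧ and
    -- ⟦ q ⟧ equal to ⟨ p , q ⟩.
    ⟦_⟧ : Vector ℝ (suc s) → Matrix n
    ⟦ u ⟧ i j = N ⁻¹ * u (class i j)

    -- Write κ as a sum of indicators and exchange the sums: for each pair of points only the term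
    -- of its own class survives.
    κ-sum : ∀ (w : Vector ℝ (suc s)) →
            sum (λ k → fromNat (κ X α k) * w k) ≈ sum λ i → sum λ j → w (class i j)
    κ-sum w = begin
      sum (λ k → fromNat (κ X α k) * w k)
        ≈⟨ sum-cong-≋ (λ k → trans (*-comm _ (w k)) (*-congˡ (count-pairs
             (λ ij → R? X α k (proj₁ ij) (proj₂ ij)) (id {A = Fin n}) (id {A = Fin n})))) ⟩
      w ∙ (λ k → sum λ i → sum λ j → adjacency (R X α) (R? X α) k i j)
        ≈⟨ sum-combination w (λ k i → sum λ j → adjacency (R X α) (R? X α) k i j) ⟨
      sum (λ i → w ∙ (λ k → sum λ j → adjacency (R X α) (R? X α) k i j))
        ≈⟨ sum-cong-≋ (λ i → sum-combination w (λ k j → adjacency (R X α) (R? X α) k i j)) ⟨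
      sum (λ i → sum λ j → w ∙ (λ k → adjacency (R X α) (R? X α) k i j))
        ≈⟨ sum-cong-≋ (λ i → sum-cong-≋ λ j → ∙-adjacency w i j) ⟩
      sum (λ i → sum λ j → w (class i j)) ∎

    ⟦⟧-inner : ∀ (u v : Vector ℝ (suc s)) →
               (N * N) ⁻¹ * sum (λ k → fromNat (κ X α k) * (u k * v k)) ≈ ⟪ ⟦ u ⟧ , ⟦ v ⟧ ⟫
    ⟦⟧-inner u v = begin
      (N * N) ⁻¹ * sum (λ k → fromNat (κ X α k) * (u k * v k))
        ≈⟨ *-cong inverse (κ-sum λ k → u k * v k) ⟩
      N ⁻¹ * N ⁻¹ * sum (λ i → sum λ j → uv i j)
        ≈⟨ *-distribˡ-sum (N ⁻¹ * N ⁻¹) (λ i → sum λ j → uv i j) ⟩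
      sum (λ i → N ⁻¹ * N ⁻¹ * sum λ j → uv i j)
        ≈⟨ sum-cong-≋ (λ i → trans (*-distribˡ-sum (N ⁻¹ * N ⁻¹) (uv i)) (sum-cong-≋ λ j →
             solve 3 (λ x u v → x :* x :* (u :* v) := (x :* u) :* (x :* v)) refl
               (N ⁻¹) (u (class i j)) (v (class i j)))) ⟩
      ⟪ ⟦ u ⟧ , ⟦ v ⟧ ⟫ ∎
      where
      uv : Matrix n
      uv i j = u (class i j) * v (class i j)
      inverse : (N * N) ⁻¹ ≈ N ⁻¹ * N ⁻¹
      inverse = *-cancelˡ (*-nonzero N≉0 N≉0) (begin
        N * N * (N * N) ⁻¹         ≈⟨ ⁻¹-inverseʳ (*-nonzero N≉0 N≉0) ⟩
        1#                         ≈⟨ ⁻¹-inverseʳ N≉0 ⟨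
        N * N ⁻¹                   ≈⟨ *-congˡ (N*N⁻¹ (N ⁻¹)) ⟨
        N * (N * (N ⁻¹ * N ⁻¹))    ≈⟨ *-assoc _ _ _ ⟨
        N * N * (N ⁻¹ * N ⁻¹)      ∎)

    ⟦⟧-cong : ∀ {u v : Vector ℝ (suc s)} → (∀ k → u k ≈ v k) → ⟦ u ⟧ ≋ᴹ ⟦ v ⟧
    ⟦⟧-cong e i j = *-congˡ (e (class i j))

    ⟦⟧-+ : ∀ (u v : Vector ℝ (suc s)) → ⟦ (λ k → u k + v k) ⟧ ≋ᴹ ⟦ u ⟧ +ᴹ ⟦ v ⟧
    ⟦⟧-+ u v i j = distribˡ (N ⁻¹) _ _

    ⟦⟧-scale : ∀ (c : ℝ) (u : Vector ℝ (suc s)) → ⟦ (λ k → c * u k) ⟧ ≋ᴹ scale c ⟦ u ⟧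
    ⟦⟧-scale c u i j = solve 3 (λ x y z → x :* (y :* z) := y :* (x :* z)) refl (N ⁻¹) c _

    ⟦⟧-combination : ∀ {k} (c : Vector ℝ k) (u : Fin k → Vector ℝ (suc s)) →
                     ⟦ (λ l → c ∙ (λ h → u h l)) ⟧ ≋ᴹ combination c (λ h → ⟦ u h ⟧)
    ⟦⟧-combination c u i j = sym (∙-scaleʳ (N ⁻¹) c (λ h → u h (class i j)))

    -- Every class contains a pair, so each value of u occurs as an entry of the matrix, up to the
    -- factor 1/n.
    ⟦⟧-definite : ∀ (u : Vector ℝ (suc s)) → ⟪ ⟦ u ⟧ , ⟦ u ⟧ ⟫ ≈ 0# → ∀ k → u k ≈ 0#
    ⟦⟧-definite u e k = let (i , j , r) = R-nonempty k in
      ≡.subst (λ k → u k ≈ 0#) (class-unique {k} {i} {j} r)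
        (*-cancel-0 (⁻¹-nonzero N≉0) (⟪⟫-definite ⟦ u ⟧ e i j))

    values : ∀ {d} → Poly≤ d → Vector ℝ (suc s)
    values p k = eval p (A′ X α k)

    ⟦values⟧ : ∀ {d} (p : Poly≤ d) i j → N * ⟦ values p ⟧ i j ≈ eval p (X i ∙ X j)
    ⟦values⟧ p i j = trans (N*N⁻¹ _) (eval-cong p (sym (class-R i j)))

    -- Here p is a multiple of w plus a polynomial of lower degree. It is used both with w a
    -- predegree polynomial and with w = t q_k.
    ⟪⟫-degree-step : ∀ {d} (p w : Poly≤ (suc d)) (M : Matrix n) → HasExactDegree (suc d) w →
                     ⟪ ⟦ values w ⟧ , M ⟫ ≈ 0# →
                     (∀ (r : Poly≤ d) → ⟪ ⟦ values r ⟧ , M ⟫ ≈ 0#) →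
                     ⟪ ⟦ values p ⟧ , M ⟫ ≈ 0#
    ⟪⟫-degree-step p w M w≉0 w⟂M low = let (c , r , eq) = eliminate-leading p w w≉0 in begin
      ⟪ ⟦ values p ⟧ , M ⟫
        ≈⟨ ⟪⟫-cong {B = M} (λ i j → trans (⟦⟧-cong (λ k → eq (A′ X α k)) i j)
             (trans (⟦⟧-+ (λ k → c * values w k) (values r) i j) (+-congʳ (⟦⟧-scale c (values w) i j))))
             (λ _ _ → refl) ⟩
      ⟪ scale c ⟦ values w ⟧ +ᴹ ⟦ values r ⟧ , M ⟫
        ≈⟨ ⟪⟫-distribʳ (scale c ⟦ values w ⟧) ⟦ values r ⟧ M ⟩
      ⟪ scale c ⟦ values w ⟧ , M ⟫ + ⟪ ⟦ values r ⟧ , M ⟫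
        ≈⟨ +-cong (trans (⟪⟫-scaleˡ c ⟦ values w ⟧ M) (trans (*-congˡ w⟂M) (zeroʳ c))) (low r) ⟩
      0# + 0#   ≈⟨ +-identityʳ 0# ⟩
      0#        ∎

  -- Matrices of the predegree polynomials

  module Excess {m n s : ℕ} (1≤m : 1 ℕ.≤ m) (X : Fin n → Vector ℝ m)
    (distinct : AreDistinct X) (sphere : OnSphere X) (design : IsSpherical2Design X)
    (α : Vector ℝ s) (distances : IsDistanceSet X s α)
    (F : ℕ → Matrix n) (projections : AreProjectionMatrices X s F)
    (q : ∀ k → Poly≤ k) (predegree : ArePredegreePolynomials X α q) where

    a₀ : Fin n
    a₀ = design-nonempty X design

    open Relations X distinct sphere a₀ α distances public
    open ArePredegreePolynomials predegree

    -- For k at most s this number is both the trace and the squared norm of `E k`.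
    μ : ℕ → ℝ
    μ k = eval (q k) (fromNat m)

    E : ℕ → Matrix n
    E k = ⟦ values (q k) ⟧

    toℕ≤s : ∀ (l : Fin (suc s)) → toℕ l ℕ.≤ s
    toℕ≤s l = ℕ.s≤s⁻¹ (toℕ<n l)

    E-norm : ∀ {k} → k ℕ.≤ s → ⟪ E k , E k ⟫ ≈ μ k
    E-norm {k} k≤s = trans (sym (⟦⟧-inner (values (q k)) (values (q k)))) (norm k k≤s)

    E-orthogonal : ∀ {k l} → k ℕ.≤ s → l ℕ.≤ s → k ≢ l → ⟪ E k , E l ⟫ ≈ 0#
    E-orthogonal {k} {l} k≤s l≤s k≢l =
      trans (sym (⟦⟧-inner (values (q k)) (values (q l)))) (orthogonal k l k≤s l≤s k≢l)

    -- Having exact degrees 0, ..., d, the polynomials q_0, ..., q_d span all those of degree at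
    -- most d.
    ⟂E⇒⟂values : ∀ d → d ℕ.≤ s → (M : Matrix n) → (∀ k → k ℕ.≤ d → ⟪ E k , M ⟫ ≈ 0#) →
                 (p : Poly≤ d) → ⟪ ⟦ values p ⟧ , M ⟫ ≈ 0#
    ⟂E⇒⟂values zero    d≤s M ⟂ p = begin
      ⟪ ⟦ values p ⟧ , M ⟫          ≈⟨ ⟪⟫-cong {B = M} (λ i j → trans (⟦⟧-cong constant i j) (⟦⟧-scale c (values (q 0)) i j)) (λ _ _ → refl) ⟩
      ⟪ scale c (E 0) , M ⟫         ≈⟨ ⟪⟫-scaleˡ c (E 0) M ⟩
      c * ⟪ E 0 , M ⟫               ≈⟨ trans (*-congˡ (⟂ 0 z≤n)) (zeroʳ c) ⟩
      0#                            ∎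
      where
      c = q 0 zero ⁻¹ * p zero
      constant : ∀ k → values p k ≈ c * values (q 0) k
      constant k = trans (eval-constant p (A′ X α k)) (sym (trans
        (trans (*-congˡ (eval-constant (q 0) (A′ X α k))) (*-comm c _)) (⁻¹*-cancel _ (degree 0 z≤n))))
    ⟂E⇒⟂values (suc d) d≤s M ⟂ p = ⟪⟫-degree-step p (q (suc d)) M (degree (suc d) d≤s)
      (⟂ (suc d) ℕₚ.≤-refl)
      (⟂E⇒⟂values d (ℕₚ.<⇒≤ d≤s) M (λ k k≤d → ⟂ k (ℕₚ.m≤n⇒m≤1+n k≤d)))

    lower⟂E : ∀ {d k} → d ℕ.< k → k ℕ.≤ s → (p : Poly≤ d) → ⟪ ⟦ values p ⟧ , E k ⟫ ≈ 0#
    lower⟂E {d} {k} d<k k≤s = ⟂E⇒⟂values d (ℕₚ.<⇒≤ (ℕₚ.<-≤-trans d<k k≤s)) (E k)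
      λ j j≤d → E-orthogonal (ℕₚ.≤-trans j≤d (ℕₚ.<⇒≤ (ℕₚ.<-≤-trans d<k k≤s))) k≤s
        (ℕₚ.<⇒≢ (ℕₚ.≤-<-trans j≤d d<k))

    -- If ‖`E k`‖² vanished, q_k would vanish on A′(X); already k + 1 of its s + 1 points force the
    -- leading coefficient to be zero.
    μ≉0 : ∀ {k} → k ℕ.≤ s → ¬ μ k ≈ 0#
    μ≉0 {k} k≤s e = degree k k≤s (leading-vanishes (λ l → A′ X α (inject≤ l 1+k≤1+s))
      (λ i j p → inject≤-injective 1+k≤1+s 1+k≤1+s i j (A′-distinct _ _ p)) (q k)
      (λ l → ⟦⟧-definite (values (q k)) (trans (E-norm k≤s) e) (inject≤ l 1+k≤1+s)))
      where
      1+k≤1+s = s≤s k≤s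

    coefficient : Vector ℝ (suc s) → Vector ℝ (suc s)
    coefficient u l = μ (toℕ l) ⁻¹ * ⟪ ⟦ u ⟧ , E (toℕ l) ⟫

    -- The predegree polynomials form a basis of the functions on A′(X): the
    -- remainder r is orthogonal to all polynomials of degree at most s, and it
    -- is one of them by interpolation.
    expansion : ∀ (u : Vector ℝ (suc s)) → ⟦ u ⟧ ≋ᴹ combination (coefficient u) (E ∘ toℕ)
    expansion u i j = trans (⟦⟧-cong (λ k → x-y≈0⇒x≈y (⟦⟧-definite r r⟂r k)) i j)
      (⟦⟧-combination c (λ l → values (q (toℕ l))) i j)
      where
      c = coefficient u
      v r : Vector ℝ (suc s)
      v k = c ∙ (λ l → values (q (toℕ l)) k)
      r k = u k - v k
      p = proj₁ (interpolate (A′ X α) A′-distinct r)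
      p≈r = proj₂ (interpolate (A′ X α) A′-distinct r)
      v-inner : ∀ (l : Fin (suc s)) → ⟪ ⟦ v ⟧ , E (toℕ l) ⟫ ≈ ⟪ ⟦ u ⟧ , E (toℕ l) ⟫
      v-inner l = begin
        ⟪ ⟦ v ⟧ , E (toℕ l) ⟫
          ≈⟨ ⟪⟫-cong {B = E (toℕ l)} (⟦⟧-combination c (λ l → values (q (toℕ l)))) (λ _ _ → refl) ⟩
        ⟪ combination c (E ∘ toℕ) , E (toℕ l) ⟫
          ≈⟨ ⟪⟫-combinationˡ c (E ∘ toℕ) (E (toℕ l)) ⟩
        c ∙ (λ h → ⟪ E (toℕ h) , E (toℕ l) ⟫)
          ≈⟨ sum-single l (λ h l≢h → trans (*-congˡ {c h} (E-orthogonal (toℕ≤s h) (toℕ≤s l)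
               (λ e → l≢h (≡.sym (toℕ-injective e))))) (zeroʳ _)) ⟩
        c l * ⟪ E (toℕ l) , E (toℕ l) ⟫
          ≈⟨ trans (*-congˡ (E-norm (toℕ≤s l))) (*-comm (c l) _) ⟩
        μ (toℕ l) * c l
          ≈⟨ ⁻¹*-cancel _ (μ≉0 (toℕ≤s l)) ⟩
        ⟪ ⟦ u ⟧ , E (toℕ l) ⟫ ∎
      E⟂r′ : ∀ (l : Fin (suc s)) → ⟪ E (toℕ l) , ⟦ r ⟧ ⟫ ≈ 0#
      E⟂r′ l = trans (⟪⟫-comm (E (toℕ l)) ⟦ r ⟧) (+-cancelˡ ⟪ ⟦ v ⟧ , E (toℕ l) ⟫ _ _ (begin
        ⟪ ⟦ v ⟧ , E (toℕ l) ⟫ + ⟪ ⟦ r ⟧ , E (toℕ l) ⟫  ≈⟨ ⟪⟫-distribʳ ⟦ v ⟧ ⟦ r ⟧ (E (toℕ l)) ⟨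
        ⟪ ⟦ v ⟧ +ᴹ ⟦ r ⟧ , E (toℕ l) ⟫                 ≈⟨ ⟪⟫-cong {B = E (toℕ l)} (λ i j → trans (sym (⟦⟧-+ v r i j))
                                                            (⟦⟧-cong (λ k → sym (x≈y+[x-y] (u k) (v k))) i j)) (λ _ _ → refl) ⟩
        ⟪ ⟦ u ⟧ , E (toℕ l) ⟫                          ≈⟨ v-inner l ⟨
        ⟪ ⟦ v ⟧ , E (toℕ l) ⟫                          ≈⟨ +-identityʳ _ ⟨
        ⟪ ⟦ v ⟧ , E (toℕ l) ⟫ + 0#                     ∎))
      E⟂r : ∀ k → k ℕ.≤ s → ⟪ E k , ⟦ r ⟧ ⟫ ≈ 0#
      E⟂r k k≤s = ≡.subst (λ k → ⟪ E k , ⟦ r ⟧ ⟫ ≈ 0#) (toℕ-fromℕ< (s≤s k≤s)) (E⟂r′ (fromℕ< (s≤s k≤s)))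
      r⟂r : ⟪ ⟦ r ⟧ , ⟦ r ⟧ ⟫ ≈ 0#
      r⟂r = trans (⟪⟫-cong {B = ⟦ r ⟧} (⟦⟧-cong (λ k → sym (p≈r k))) (λ _ _ → refl))
        (⟂E⇒⟂values s ℕₚ.≤-refl ⟦ r ⟧ E⟂r p)

    E-column∈Pol : ∀ k j → Pol X k (λ i → E k i j)
    E-column∈Pol k j = Pol-resp X k
      (λ i → *-congˡ (eval-cong (q k) (trans (∙-comm (X j) (X i)) (class-R i j))))
      (Pol-scale X k (N ⁻¹) (ζ∈Pol X a₀ j (q k)))

    trace-E : ∀ k → trace (E k) ≈ μ k
    trace-E k = begin
      sum (λ i → N ⁻¹ * values (q k) (class i i))
        ≈⟨ sum-cong-≋ (λ i → *-congˡ (eval-cong (q k) (trans (sym (class-R i i)) (sphere i)))) ⟩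
      sum {n} (λ _ → N ⁻¹ * μ k)    ≈⟨ sum-const {n} (N ⁻¹ * μ k) ⟩
      N * (N ⁻¹ * μ k)              ≈⟨ N*N⁻¹ (μ k) ⟩
      μ k                           ∎

    -- The coefficient at `E l` is tr `E l` / ‖`E l`‖², and the normalisation of q_l makes both
    -- equal to q_l(m).
    identity-expansion : δ ≋ᴹ combination {suc s} (λ _ → 1#) (E ∘ toℕ)
    identity-expansion i j = begin
      δ i j                                         ≈⟨ δ≋⟦u⟧ i j ⟩
      ⟦ u ⟧ i j                                     ≈⟨ expansion u i j ⟩
      combination (coefficient u) (E ∘ toℕ) i j     ≈⟨ sum-cong-≋ {suc s} (λ l → *-congʳ {E (toℕ l) i j} (coefficient≈1 l)) ⟩
      combination {suc s} (λ _ → 1#) (E ∘ toℕ) i j  ∎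
      where
      u : Vector ℝ (suc s)
      -- Index zero is the value m, that is, the diagonal; the factor n cancels the 1/n in `⟦_⟧`.
      u k = N * δ zero k
      δ≋⟦u⟧ : δ ≋ᴹ ⟦ u ⟧
      δ≋⟦u⟧ i j = trans (δ-class i j) (sym (N⁻¹*N _))
      coefficient≈1 : ∀ l → coefficient u l ≈ 1#
      coefficient≈1 l = begin
        μ (toℕ l) ⁻¹ * ⟪ ⟦ u ⟧ , E (toℕ l) ⟫   ≈⟨ *-congˡ (begin
          ⟪ ⟦ u ⟧ , E (toℕ l) ⟫                     ≈⟨ ⟪⟫-cong {B = E (toℕ l)} δ≋⟦u⟧ (λ _ _ → refl) ⟨
          ⟪ δ , E (toℕ l) ⟫                         ≈⟨ ⟪⟫-comm δ (E (toℕ l)) ⟩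
          ⟪ E (toℕ l) , δ ⟫                         ≈⟨ ⟪⟫-identity (E (toℕ l)) ⟩
          trace (E (toℕ l))                         ≈⟨ trace-E (toℕ l) ⟩
          μ (toℕ l)                                 ∎) ⟩
        μ (toℕ l) ⁻¹ * μ (toℕ l)               ≈⟨ trans (*-comm _ _) (⁻¹-inverseʳ (μ≉0 (toℕ≤s l))) ⟩
        1#                                     ∎

    -- Projections against predegree matrices: the excess q_s(m) - tr F_s

    module Projection {k} (k≤s : k ℕ.≤ s) = OrthogonalProjection (Harm X k)
      (Harm-resp X k) (Harm-sub X a₀ k) (F k) (λ f → proj₁ (projections k k≤s f))
      (λ f g w → inner≈0⇒∙≈0 X a₀ _ g (proj₂ (projections k k≤s f) g w))
    open Projection

    ⟪F,E⟫≈0 : ∀ {k l} → k ℕ.≤ s → l ℕ.< k → ⟪ F k , E l ⟫ ≈ 0#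
    ⟪F,E⟫≈0 {k} {l} k≤s l<k = F-perpendicular k≤s (E l)
      λ j g g∈Harm → Pol⟂Harm X a₀ {f = λ i → E l i j} {g} l<k (E-column∈Pol l j) g∈Harm

    ⟪Fₛ,Eₛ⟫ : ⟪ F s , E s ⟫ ≈ trace (F s)
    ⟪Fₛ,Eₛ⟫ = sym (begin
      trace (F s)                                      ≈⟨ ⟪⟫-identity (F s) ⟨
      ⟪ F s , δ ⟫                                      ≈⟨ ⟪⟫-cong {A = F s} (λ _ _ → refl) identity-expansion ⟩
      ⟪ F s , combination {suc s} (λ _ → 1#) (E ∘ toℕ) ⟫       ≈⟨ ⟪⟫-combinationʳ {k = suc s} (λ _ → 1#) (E ∘ toℕ) (F s) ⟩
      (λ _ → 1#) ∙ (λ (l : Fin (suc s)) → ⟪ F s , E (toℕ l) ⟫)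
        ≈⟨ sum-single (fromℕ s) (λ l s≢l → trans (*-identityˡ _)
             (⟪F,E⟫≈0 ℕₚ.≤-refl (ℕₚ.≤∧≢⇒< (toℕ≤s l) λ e → s≢l (toℕ-injective (≡.trans (toℕ-fromℕ s) (≡.sym e)))))) ⟩
      1# * ⟪ F s , E (toℕ (fromℕ s)) ⟫                 ≈⟨ *-identityˡ _ ⟩
      ⟪ F s , E (toℕ (fromℕ s)) ⟫                      ≡⟨ ≡.cong (λ k → ⟪ F s , E k ⟫) (toℕ-fromℕ s) ⟩
      ⟪ F s , E s ⟫                                    ∎)

    excess : μ s ≈ trace (F s) + ⟪ E s -ᴹ F s , E s -ᴹ F s ⟫
    excess = begin
      μ s                                              ≈⟨ E-norm ℕₚ.≤-refl ⟨
      ⟪ E s , E s ⟫                                    ≈⟨ pythagoras (F s) (E s) (trans ⟪Fₛ,Eₛ⟫ (sym (F-norm ℕₚ.≤-refl))) ⟩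
      ⟪ F s , F s ⟫ + ⟪ E s -ᴹ F s , E s -ᴹ F s ⟫      ≈⟨ +-congʳ (F-norm ℕₚ.≤-refl) ⟩
      trace (F s) + ⟪ E s -ᴹ F s , E s -ᴹ F s ⟫        ∎

    equality⇒Eₛ≋Fₛ : trace (F s) ≈ μ s → E s ≋ᴹ F s
    equality⇒Eₛ≋Fₛ e i j = x-y≈0⇒x≈y (⟪⟫-definite (E s -ᴹ F s)
      (+-cancelˡ (trace (F s)) _ _ (trans (sym excess) (trans (sym e) (sym (+-identityʳ _))))) i j)

    -- If s were 0, every x · y would be m, and a row of inner products would sum to n m, which is
    -- nonzero, against `design₁`. The bound brings `F 1` into the range that the projection
    -- hypotheses cover.
    1≤s : 1 ℕ.≤ s
    1≤s with s ℕₚ.≟ 0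
    ... | no  s≢0 = ℕₚ.n≢0⇒n>0 s≢0
    ... | yes ≡.refl = contradiction (begin
      N * fromNat m             ≈⟨ sum-const {n} (fromNat m) ⟨
      sum {n} (λ _ → fromNat m) ≈⟨ sum-cong-≋ {n} (λ i → trans (class-R a₀ i) (single (class a₀ i))) ⟨
      sum (λ i → X a₀ ∙ X i)    ≈⟨ design₁ X design a₀ ⟩
      0#                        ∎) (*-nonzero N≉0 (fromNat-nonzero 1≤m))
      where
      single : ∀ (k : Fin 1) → A′ X α k ≈ fromNat m
      single zero = refl

    -- Each matrix fixes the columns of the other. Transposing `gram` · `F 1` = `F 1` by symmetry
    -- gives `F 1` = `F 1` · `gram` = `gram`.
    F₁≋gram : F 1 ≋ᴹ gram X design
    F₁≋gram i j = begin
      F 1 i j                        ≈⟨ F-symmetric 1≤s i j ⟩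
      F 1 j i                        ≈⟨ gram-fixes-Harm₁ X design _ (F-column 1≤s i) j ⟨
      (gram X design *ᴹ F 1) j i     ≈⟨ ∙-comm (gram X design j) (λ k → F 1 k i) ⟩
      (λ k → F 1 k i) ∙ gram X design j
        ≈⟨ ∙-cong (λ k → F-symmetric 1≤s k i) (λ k → gram-symmetric X design j k) ⟩
      (F 1 *ᴹ gram X design) i j     ≈⟨ F-fixes 1≤s _ (gram-column∈Harm₁ X design j) i ⟩
      gram X design i j              ∎

    N*F₁ : ∀ i j → N * F 1 i j ≈ X i ∙ X j
    N*F₁ i j = trans (*-congˡ (F₁≋gram i j)) (N*N⁻¹ _)

    -- A Q-polynomial scheme attains equality

    module _ (scheme : IsQPolynomialScheme X α F) where

      open IsQPolynomialScheme scheme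

      private
        v = proj₁ (qPolynomial s ℕₚ.≤-refl)
        t = trace (F s)
        -- The coefficient of `E s` in `F s`, namely ⟪`F s`, `E s`⟫ / ‖`E s`‖², whose numerator is
        -- tr `F s`.
        ρ = μ s ⁻¹ * t

        Fₛ≋⟦v⟧ : F s ≋ᴹ ⟦ values v ⟧
        Fₛ≋⟦v⟧ i j = *-cancelˡ N≉0 (begin
          N * F s i j              ≈⟨ proj₂ (proj₂ (qPolynomial s ℕₚ.≤-refl)) i j ⟩
          eval v (N * F 1 i j)     ≈⟨ eval-cong v (N*F₁ i j) ⟩
          eval v (X i ∙ X j)       ≈⟨ ⟦values⟧ v i j ⟨
          N * ⟦ values v ⟧ i j     ∎)

        ⟪v,E⟫ : ∀ k → ⟪ ⟦ values v ⟧ , E k ⟫ ≈ ⟪ F s , E k ⟫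
        ⟪v,E⟫ k = ⟪⟫-cong {B = E k} (λ i j → sym (Fₛ≋⟦v⟧ i j)) (λ _ _ → refl)

        Fₛ≋ρEₛ : F s ≋ᴹ scale ρ (E s)
        Fₛ≋ρEₛ i j = begin
          F s i j                                              ≈⟨ Fₛ≋⟦v⟧ i j ⟩
          ⟦ values v ⟧ i j                                     ≈⟨ expansion (values v) i j ⟩
          combination (coefficient (values v)) (E ∘ toℕ) i j
            ≈⟨ sum-single {suc s} (fromℕ s) (λ l s≢l → trans (*-congʳ {E (toℕ l) i j} (trans (*-congˡ {μ (toℕ l) ⁻¹} (trans (⟪v,E⟫ (toℕ l))
                 (⟪F,E⟫≈0 ℕₚ.≤-refl (ℕₚ.≤∧≢⇒< (toℕ≤s l) λ e → s≢l (toℕ-injective (≡.trans (toℕ-fromℕ s) (≡.sym e)))))))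
                 (zeroʳ (μ (toℕ l) ⁻¹)))) (zeroˡ (E (toℕ l) i j))) ⟩
          μ (toℕ (fromℕ s)) ⁻¹ * ⟪ ⟦ values v ⟧ , E (toℕ (fromℕ s)) ⟫ * E (toℕ (fromℕ s)) i j
            ≡⟨ ≡.cong (λ k → μ k ⁻¹ * ⟪ ⟦ values v ⟧ , E k ⟫ * E k i j) (toℕ-fromℕ s) ⟩
          μ s ⁻¹ * ⟪ ⟦ values v ⟧ , E s ⟫ * E s i j            ≈⟨ *-congʳ (*-congˡ (trans (⟪v,E⟫ s) ⟪Fₛ,Eₛ⟫)) ⟩
          ρ * E s i j                                          ∎

        -- A primitive idempotent is nonzero and tr `F s` is its squared norm; this permits
        -- cancelling `t` in `t` = ρ `t`.
        t≉0 : ¬ t ≈ 0#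
        t≉0 t≈0 = IsPrimitiveIdempotent.nonzero
          (PrimitiveIdempotentsAre.isPrimitive idempotents s ℕₚ.≤-refl)
          (⟪⟫-definite (F s) (trans (F-norm ℕₚ.≤-refl) t≈0))

        ρ≈1 : ρ ≈ 1#
        ρ≈1 = *-cancelˡ t≉0 (begin
          t * ρ                      ≈⟨ *-comm t ρ ⟩
          ρ * t                      ≈⟨ *-congˡ ⟪Fₛ,Eₛ⟫ ⟨
          ρ * ⟪ F s , E s ⟫          ≈⟨ ⟪⟫-scaleʳ ρ (F s) (E s) ⟨
          ⟪ F s , scale ρ (E s) ⟫    ≈⟨ ⟪⟫-cong {A = F s} (λ _ _ → refl) Fₛ≋ρEₛ ⟨
          ⟪ F s , F s ⟫              ≈⟨ F-norm ℕₚ.≤-refl ⟩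
          t                          ≈⟨ *-identityʳ t ⟨
          t * 1#                     ∎)

      scheme⇒equality : trace (F s) ≈ μ s
      scheme⇒equality = begin
        t                  ≈⟨ ⁻¹*-cancel t (μ≉0 ℕₚ.≤-refl) ⟨
        μ s * ρ            ≈⟨ *-congˡ ρ≈1 ⟩
        μ s * 1#           ≈⟨ *-identityʳ (μ s) ⟩
        μ s                ∎

    -- Descent from the top degree to all degrees

    F-orthogonal-< : ∀ {k l} → k ℕ.< l → l ℕ.≤ s → F k *ᴹ F l ≋ᴹ 0ᴹ
    F-orthogonal-< {k} {l} k<l l≤s i j = begin
      F k i ∙ (λ x → F l x j)             ≈⟨ ∙-cong (λ x → F-symmetric k≤s i x) (λ _ → refl) ⟩
      (λ x → F k x i) ∙ (λ x → F l x j)   ≈⟨ Pol⟂Harm X a₀ {f = λ x → F k x i} {λ x → F l x j} k<l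
                                               (Harm⇒Pol X k (F-column k≤s i)) (F-column l≤s j) ⟩
      0#                                  ∎
      where
      k≤s = ℕₚ.<⇒≤ (ℕₚ.<-≤-trans k<l l≤s)

    F-orthogonal : ∀ {k l} → k ℕ.≤ s → l ℕ.≤ s → k ≢ l → F k *ᴹ F l ≋ᴹ 0ᴹ
    F-orthogonal {k} {l} k≤s l≤s k≢l i j with ℕₚ.<-cmp k l
    ... | tri< k<l _ _ = F-orthogonal-< k<l l≤s i j
    ... | tri≈ _ k≡l _ = contradiction k≡l k≢l
    ... | tri> _ _ l<k = begin
      F k i ∙ (λ x → F l x j)             ≈⟨ ∙-cong (λ x → F-symmetric k≤s i x) (λ x → F-symmetric l≤s x j) ⟩
      (λ x → F k x i) ∙ F l j             ≈⟨ ∙-comm (λ x → F k x i) (F l j) ⟩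
      (F l *ᴹ F k) j i                    ≈⟨ F-orthogonal-< l<k k≤s j i ⟩
      0#                                  ∎

    -- Kept as a function on A′(X): at k = s the polynomial t q_s would have degree s + 1, but
    -- `expansion` accepts any function.
    times-t : ℕ → Vector ℝ (suc s)
    times-t k l = A′ X α l * values (q k) l

    -- Multiplication by t is self-adjoint, so the factor moves to q_l, where it yields a polynomial
    -- of degree l + 1.
    ⟪times-t,E⟫ : ∀ k l → ⟪ ⟦ times-t k ⟧ , E l ⟫ ≈ ⟪ ⟦ values (0# ∷ q l) ⟧ , E k ⟫
    ⟪times-t,E⟫ k l = sum-cong-≋ λ i → sum-cong-≋ λ j → let x = class i j in begin
      N ⁻¹ * (A′ X α x * values (q k) x) * (N ⁻¹ * values (q l) x)
        ≈⟨ solve 4 (λ a t u v → a :* (t :* u) :* (a :* v) := a :* (t :* v) :* (a :* u)) refl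
             (N ⁻¹) (A′ X α x) (values (q k) x) (values (q l) x) ⟩
      N ⁻¹ * (A′ X α x * values (q l) x) * (N ⁻¹ * values (q k) x)
        ≈⟨ *-congʳ (*-congˡ (eval-*t (q l) (A′ X α x))) ⟨
      N ⁻¹ * values (0# ∷ q l) x * (N ⁻¹ * values (q k) x) ∎

    -- Multiplication by t is tridiagonal in the basis of the q_k, with nonzero
    -- entries next to the diagonal.
    coefficient-lower : ∀ {k} {l : Fin (suc s)} → suc k ℕ.≤ s → toℕ l ℕ.< k →
                        coefficient (times-t (suc k)) l ≈ 0#
    coefficient-lower {k} {l} k<s l<k = trans (*-congˡ (trans (⟪times-t,E⟫ (suc k) (toℕ l))
      (lower⟂E (s≤s l<k) k<s (0# ∷ q (toℕ l))))) (zeroʳ _)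

    -- Were it zero, t q_k, of exact degree k + 1, and everything of lower degree would be
    -- orthogonal to `E (suc k)`. Then q_{k+1} would be orthogonal to itself.
    coefficient-next : ∀ {k} {l : Fin (suc s)} → suc k ℕ.≤ s → toℕ l ≡ k →
                       ¬ coefficient (times-t (suc k)) l ≈ 0#
    coefficient-next {k} {l} k<s ≡.refl = *-nonzero (⁻¹-nonzero (μ≉0 (ℕₚ.<⇒≤ k<s))) λ e →
      μ≉0 k<s (trans (sym (E-norm k<s)) (⟪⟫-degree-step (q (suc k)) (0# ∷ q k) (E (suc k))
        (degree k (ℕₚ.<⇒≤ k<s)) (trans (sym (⟪times-t,E⟫ (suc k) k)) e)
        (lower⟂E ℕₚ.≤-refl k<s)))

    AgreeFrom : ℕ → Set
    AgreeFrom k = ∀ l → k ℕ.≤ l → l ℕ.≤ s → E l ≋ᴹ F l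

    -- In positive degree, expand t q_K, with K one above the degree in question. Terms below K - 1
    -- are absent, those from K on have columns in harmonic spaces orthogonal to g, and t q_K itself
    -- is orthogonal to g. So the K - 1 term is too, and its coefficient is nonzero.
    E-column∈Harm : ∀ k → suc k ℕ.≤ s → AgreeFrom (suc k) → ∀ y → Harm X k (λ x → E k x y)
    E-column∈Harm zero    k<s agree y = E-column∈Pol 0 y
    E-column∈Harm (suc k) k<s agree y = E-column∈Pol (suc k) y ,
      λ g g∈Pol → ∙≈0⇒inner≈0 X a₀ (λ x → E (suc k) x y) g (orthogonal′ g g∈Pol)
      where
      K = suc (suc k)
      c = coefficient (times-t K)
      κ′ : Fin (suc s)
      κ′ = fromℕ< (ℕₚ.m≤n⇒m≤1+n k<s)
      toℕ-κ′ : toℕ κ′ ≡ suc k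
      toℕ-κ′ = toℕ-fromℕ< (ℕₚ.m≤n⇒m≤1+n k<s)
      module _ (g : Vector ℝ n) (g∈Pol : Pol X k g) where
        column : Fin (suc s) → Vector ℝ n
        column l x = E (toℕ l) x y
        others : ∀ l → κ′ ≢ l → c l * (column l ∙ g) ≈ 0#
        others l κ′≢l with ℕₚ.<-cmp (toℕ l) (suc k)
        ... | tri< l<k _ _ = trans (*-congʳ (coefficient-lower k<s l<k)) (zeroˡ _)
        ... | tri≈ _ l≡k _ = contradiction (toℕ-injective (≡.trans toℕ-κ′ (≡.sym l≡k))) κ′≢l
        ... | tri> _ _ k<l = trans (*-congˡ (begin
          column l ∙ g                     ≈⟨ ∙-cong {g = g} (λ x → agree (toℕ l) k<l (toℕ≤s l) x y) (λ _ → refl) ⟩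
          (λ x → F (toℕ l) x y) ∙ g        ≈⟨ ∙-comm (λ x → F (toℕ l) x y) g ⟩
          g ∙ (λ x → F (toℕ l) x y)        ≈⟨ Pol⟂Harm X a₀ {f = g} {λ x → F (toℕ l) x y}
                                                (ℕₚ.<-trans (ℕₚ.n<1+n k) k<l) g∈Pol (F-column (toℕ≤s l) y) ⟩
          0#                               ∎)) (zeroʳ _)
        -- On each entry t is x · y. Moved onto g, this factor gives a function in `Pol (suc k)`,
        -- still below the degree K of the column of `F K`.
        times-t⟂g : (λ x → ⟦ times-t K ⟧ x y) ∙ g ≈ 0#
        times-t⟂g = begin
          (λ x → ⟦ times-t K ⟧ x y) ∙ g
            ≈⟨ sum-cong-≋ (λ x → begin
                 N ⁻¹ * (A′ X α (class x y) * values (q K) (class x y)) * g x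
                   ≈⟨ solve 4 (λ a t u g → a :* (t :* u) :* g := (t :* g) :* (a :* u)) refl
                        (N ⁻¹) (A′ X α (class x y)) (values (q K) (class x y)) (g x) ⟩
                 (A′ X α (class x y) * g x) * E K x y
                   ≈⟨ *-cong (*-congʳ (trans (sym (class-R x y)) (∙-comm (X x) (X y)))) (agree K ℕₚ.≤-refl k<s x y) ⟩
                 (X y ∙ X x) * g x * F K x y ∎) ⟩
          (λ x → (X y ∙ X x) * g x) ∙ (λ x → F K x y)
            ≈⟨ Pol⟂Harm X a₀ {suc k} {K} {λ x → (X y ∙ X x) * g x} {λ x → F K x y} ℕₚ.≤-refl
                 (Pol-* X k (Pol₁-linear X a₀ y) g∈Pol) (F-column k<s y) ⟩
          0# ∎
        orthogonal′ : (λ x → E (suc k) x y) ∙ g ≈ 0#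
        orthogonal′ = *-cancel-0 (coefficient-next {l = κ′} k<s toℕ-κ′) (begin
          c κ′ * ((λ x → E (suc k) x y) ∙ g)      ≡⟨ ≡.cong (λ l → c κ′ * ((λ x → E l x y) ∙ g)) toℕ-κ′ ⟨
          c κ′ * (column κ′ ∙ g)                  ≈⟨ sum-single κ′ others ⟨
          c ∙ (λ l → column l ∙ g)                ≈⟨ ∙-combination c column g ⟨
          (λ x → c ∙ (λ l → column l x)) ∙ g      ≈⟨ ∙-cong {g = g} (λ x → expansion (times-t K) x y) (λ _ → refl) ⟨
          (λ x → ⟦ times-t K ⟧ x y) ∙ g           ≈⟨ times-t⟂g ⟩
          0#                                      ∎)

    -- Multiply the expansion of the identity by `F k`. Terms l < k die by degree, terms l > k
    -- because there `E l` = `F l`, and `F k` fixes the columns of `E k`.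
    agree-step : ∀ k → suc k ℕ.≤ s → AgreeFrom (suc k) → E k ≋ᴹ F k
    agree-step k k<s agree i j = sym (begin
      F k i j                                             ≈⟨ ∙-δ j (F k i) ⟨
      F k i ∙ δ j                                         ≈⟨ ∙-cong {f = F k i} (λ _ → refl)
                                                               (λ x → trans (δ-comm j x) (identity-expansion x j)) ⟩
      (F k *ᴹ combination {suc s} (λ _ → 1#) (E ∘ toℕ)) i j ≈⟨ *ᴹ-combinationʳ {k = suc s} (λ _ → 1#) (E ∘ toℕ) (F k) i j ⟩
      (λ _ → 1#) ∙ (λ (l : Fin (suc s)) → (F k *ᴹ E (toℕ l)) i j)
        ≈⟨ sum-single {suc s} k′ (λ l k′≢l → trans (*-identityˡ _) (others l k′≢l)) ⟩
      1# * (F k *ᴹ E (toℕ k′)) i j                        ≈⟨ *-identityˡ _ ⟩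
      (F k *ᴹ E (toℕ k′)) i j                             ≡⟨ ≡.cong (λ l → (F k *ᴹ E l) i j) toℕ-k′ ⟩
      (F k *ᴹ E k) i j                                    ≈⟨ F-fixes k≤s (λ x → E k x j) (E-column∈Harm k k<s agree j) i ⟩
      E k i j                                             ∎)
      where
      k≤s = ℕₚ.<⇒≤ k<s
      k′ : Fin (suc s)
      k′ = fromℕ< (s≤s k≤s)
      toℕ-k′ : toℕ k′ ≡ k
      toℕ-k′ = toℕ-fromℕ< (s≤s k≤s)
      others : ∀ (l : Fin (suc s)) → k′ ≢ l → (F k *ᴹ E (toℕ l)) i j ≈ 0#
      others l k′≢l with ℕₚ.<-cmp (toℕ l) k
      ... | tri< l<k _ _ = F-kills k≤s (λ x → E (toℕ l) x j) (λ g g∈Harm →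
        Pol⟂Harm X a₀ {f = λ x → E (toℕ l) x j} {g} l<k (E-column∈Pol (toℕ l) j) g∈Harm) i
      ... | tri≈ _ l≡k _ = contradiction (toℕ-injective (≡.trans toℕ-k′ (≡.sym l≡k))) k′≢l
      ... | tri> _ _ k<l = trans
        (*ᴹ-cong {A = F k} (λ _ _ → refl) (agree (toℕ l) k<l (toℕ≤s l)) i j)
        (F-orthogonal-< k<l (toℕ≤s l) i j)

    equality⇒agree : trace (F s) ≈ μ s → AgreeFrom 0
    equality⇒agree e = descend s 0 ≡.refl
      where
      descend : ∀ d k → k ℕ.+ d ≡ s → AgreeFrom k
      descend zero    k k+0≡s l k≤l l≤s
        with ≡.refl ← ℕₚ.≤-antisym l≤s (≡.subst (ℕ._≤ l) (≡.trans (≡.sym (ℕₚ.+-identityʳ k)) k+0≡s) k≤l)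
        = equality⇒Eₛ≋Fₛ e
      descend (suc d) k k+d≡s l k≤l l≤s with ℕₚ.m≤n⇒m<n∨m≡n k≤l
      ... | inj₁ k<l    = descend d (suc k) 1+k+d≡s l k<l l≤s
        where
        1+k+d≡s = ≡.trans (≡.sym (ℕₚ.+-suc k d)) k+d≡s
      ... | inj₂ ≡.refl = agree-step k (≡.subst (suc k ℕ.≤_) 1+k+d≡s (ℕₚ.m≤m+n (suc k) d)) (descend d (suc k) 1+k+d≡s)
        where
        1+k+d≡s = ≡.trans (≡.sym (ℕₚ.+-suc k d)) k+d≡s

    -- The scheme obtained when all E_k and F_k coincide

    module _ (agree : AgreeFrom 0) where

      private
        BM : Matrix n → Set
        BM = BoseMesner (R X α) (R? X α)

        E≋F : ∀ {k} → k ℕ.≤ s → E k ≋ᴹ F k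
        E≋F = agree _ z≤n

        Fᶠ : Fin (suc s) → Matrix n
        Fᶠ = F ∘ toℕ

        comb : Vector ℝ (suc s) → Matrix n
        comb c = combination c Fᶠ

        for-index : (P : ℕ → Set) → (∀ (l : Fin (suc s)) → P (toℕ l)) → ∀ k → k ℕ.≤ s → P k
        for-index P p k k≤s = ≡.subst P (toℕ-fromℕ< (s≤s k≤s)) (p (fromℕ< (s≤s k≤s)))

        trace-F≉0 : ∀ {k} → k ℕ.≤ s → ¬ trace (F k) ≈ 0#
        trace-F≉0 {k} k≤s e = μ≉0 k≤s (trans (sym (trace-E k)) (trans (sum-cong-≋ λ i → E≋F k≤s i i) e))

        F≉0 : ∀ {k} → k ℕ.≤ s → ¬ F k ≋ᴹ 0ᴹ
        F≉0 k≤s e = trace-F≉0 k≤s (sum-zero λ i → e i i)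

        -- Each `F l` = `E l` depends only on the class of the pair, with value q_l(α)/n on the
        -- class of α.
        comb⇒BM : ∀ {M : Matrix n} c → M ≋ᴹ comb c → BM M
        comb⇒BM {M} c M≋ = (λ k → N ⁻¹ * u k) , λ i j → begin
          M i j                                 ≈⟨ M≋ i j ⟩
          comb c i j                            ≈⟨ sum-cong-≋ {suc s} (λ l → *-congˡ {c l} (E≋F (toℕ≤s l) i j)) ⟨
          combination c (E ∘ toℕ) i j           ≈⟨ ⟦⟧-combination c (λ l → values (q (toℕ l))) i j ⟨
          ⟦ u ⟧ i j                             ≈⟨ ∙-adjacency (λ k → N ⁻¹ * u k) i j ⟨
          (λ k → N ⁻¹ * u k) ∙ (λ k → adjacency (R X α) (R? X α) k i j)  ∎
          where
          u : Vector ℝ (suc s)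
          u k = c ∙ (λ l → values (q (toℕ l)) k)

        BM⇒comb : ∀ {M : Matrix n} → BM M → Σ (Vector ℝ (suc s)) λ c → M ≋ᴹ comb c
        BM⇒comb {M} (c , M≋) = coefficient (λ k → N * c k) , λ i j → begin
          M i j                                 ≈⟨ M≋ i j ⟩
          c ∙ (λ k → adjacency (R X α) (R? X α) k i j)  ≈⟨ ∙-adjacency c i j ⟩
          c (class i j)                         ≈⟨ N⁻¹*N _ ⟨
          ⟦ (λ k → N * c k) ⟧ i j               ≈⟨ expansion (λ k → N * c k) i j ⟩
          combination (coefficient (λ k → N * c k)) (E ∘ toℕ) i j
            ≈⟨ sum-cong-≋ {suc s} (λ l → *-congˡ {coefficient (λ k → N * c k) l} (E≋F (toℕ≤s l) i j)) ⟩
          comb (coefficient (λ k → N * c k)) i j ∎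

        adjacency∈BM : ∀ k → BM (adjacency (R X α) (R? X α) k)
        adjacency∈BM k = δ k , λ i j → sym (δ-∙ k (λ l → adjacency (R X α) (R? X α) l i j))

        F≋comb : ∀ l → Fᶠ l ≋ᴹ comb (δ l)
        F≋comb l i j = sym (δ-∙ l (λ h → Fᶠ h i j))

        comb-cong : ∀ {c d : Vector ℝ (suc s)} → (∀ l → c l ≈ d l) → comb c ≋ᴹ comb d
        comb-cong c≈d i j = sum-cong-≋ {suc s} λ l → *-congʳ {Fᶠ l i j} (c≈d l)

        F-*-comb : ∀ l c → Fᶠ l *ᴹ comb c ≋ᴹ scale (c l) (Fᶠ l)
        F-*-comb l c i j = begin
          (Fᶠ l *ᴹ comb c) i j                ≈⟨ *ᴹ-combinationʳ c Fᶠ (Fᶠ l) i j ⟩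
          c ∙ (λ h → (Fᶠ l *ᴹ Fᶠ h) i j)      ≈⟨ sum-single l (λ h l≢h → trans (*-congˡ {c h}
                                                   (F-orthogonal (toℕ≤s l) (toℕ≤s h) (l≢h ∘ toℕ-injective) i j)) (zeroʳ (c h))) ⟩
          c l * (Fᶠ l *ᴹ Fᶠ l) i j            ≈⟨ *-congˡ (F-idempotent (toℕ≤s l) i j) ⟩
          c l * Fᶠ l i j                      ∎

        -- In coordinates with respect to the `F l` the Bose-Mesner algebra is ℝ^(s+1) with
        -- pointwise product. This gives closure of the scheme, and idempotents have coordinates 0
        -- and 1.
        comb-* : ∀ c d → comb c *ᴹ comb d ≋ᴹ comb (λ l → c l * d l)
        comb-* c d i j = begin
          (comb c *ᴹ comb d) i j                     ≈⟨ *ᴹ-combinationˡ c Fᶠ (comb d) i j ⟩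
          c ∙ (λ l → (Fᶠ l *ᴹ comb d) i j)           ≈⟨ sum-cong-≋ {suc s} (λ l → trans (*-congˡ {c l} (F-*-comb l d i j))
                                                          (sym (*-assoc (c l) (d l) _))) ⟩
          comb (λ l → c l * d l) i j                 ∎

        -- The coordinate of M at l is recovered as tr(`Fᶠ l` M) / tr `Fᶠ l`.
        comb-injective : ∀ {c d : Vector ℝ (suc s)} → comb c ≋ᴹ comb d → ∀ l → c l ≈ d l
        comb-injective {c} {d} e l = *-cancelˡ (trace-F≉0 (toℕ≤s l)) (begin
          trace (Fᶠ l) * c l                 ≈⟨ trace-comb c ⟨
          trace (Fᶠ l *ᴹ comb c)             ≈⟨ sum-cong-≋ (λ i → *ᴹ-cong {A = Fᶠ l} (λ _ _ → refl) e i i) ⟩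
          trace (Fᶠ l *ᴹ comb d)             ≈⟨ trace-comb d ⟩
          trace (Fᶠ l) * d l                 ∎)
          where
          trace-comb : ∀ c → trace (Fᶠ l *ᴹ comb c) ≈ trace (Fᶠ l) * c l
          trace-comb c = trans (sum-cong-≋ λ i → trans (F-*-comb l c i i) (*-comm (c l) _))
            (sym (*-distribʳ-sum (c l) (λ i → Fᶠ l i i)))

        Idempotent Primitive : Matrix n → Set
        Idempotent = IsIdempotent (R X α) (R? X α)
        Primitive = IsPrimitiveIdempotent (R X α) (R? X α)

        comb-idempotent : ∀ {M : Matrix n} c → M ≋ᴹ comb c → (∀ l → c l * c l ≈ c l) → Idempotent M
        comb-idempotent {M} c M≋ cc = record
          { member     = comb⇒BM c M≋
          ; idempotent = λ i j → trans (*ᴹ-cong M≋ M≋ i j)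
              (trans (comb-* c c i j) (trans (comb-cong cc i j) (sym (M≋ i j))))
          }

        idempotent⇒comb : ∀ {M : Matrix n} → Idempotent M →
          Σ (Vector ℝ (suc s)) λ c → M ≋ᴹ comb c × (∀ l → c l * c l ≈ c l)
        idempotent⇒comb {M} idem = c , M≋ , comb-injective λ i j →
          trans (sym (comb-* c c i j)) (trans (*ᴹ-cong (λ i j → sym (M≋ i j)) (λ i j → sym (M≋ i j)) i j)
            (trans (IsIdempotent.idempotent idem i j) (M≋ i j)))
          where
          c = proj₁ (BM⇒comb (IsIdempotent.member idem))
          M≋ = proj₂ (BM⇒comb (IsIdempotent.member idem))

        x*x≈x⇒x≈1 : ∀ {x} → ¬ x ≈ 0# → x * x ≈ x → x ≈ 1#
        x*x≈x⇒x≈1 x≉0 e = *-cancelˡ x≉0 (trans e (sym (*-identityʳ _)))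

        F-idem : ∀ l → Idempotent (Fᶠ l)
        F-idem l = comb-idempotent (δ l) (F≋comb l) δδ
          where
          δδ : ∀ h → δ l h * δ l h ≈ δ l h
          δδ h with l Fin.≟ h
          ... | yes ≡.refl = trans (*-congˡ (δ-diagonal l)) (*-identityʳ _)
          ... | no  l≢h    = trans (*-congʳ (δ-offDiagonal l≢h)) (trans (zeroˡ _) (sym (δ-offDiagonal l≢h)))

        -- Multiplying the decomposition by E′ gives E′ = `Fᶠ l` E′ = c_l `Fᶠ l`, and c_l is 0 or 1.
        F-indecomposable : ∀ l E′ E″ → Idempotent E′ → Idempotent E″ →
                           E″ *ᴹ E′ ≋ᴹ 0ᴹ → Fᶠ l ≋ᴹ (E′ +ᴹ E″) → E′ ≋ᴹ 0ᴹ ⊎ E″ ≋ᴹ 0ᴹ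
        F-indecomposable l E′ E″ idem′ idem″ E″E′≋0 F≋ = decide (c l ≟ 0#)
          where
          c = proj₁ (idempotent⇒comb idem′)
          E′≋ = proj₁ (proj₂ (idempotent⇒comb idem′))
          cc = proj₂ (proj₂ (idempotent⇒comb idem′))
          E′≋F : E′ ≋ᴹ scale (c l) (Fᶠ l)
          E′≋F i j = sym (begin
            c l * Fᶠ l i j                           ≈⟨ F-*-comb l c i j ⟨
            (Fᶠ l *ᴹ comb c) i j                     ≈⟨ *ᴹ-cong F≋ (λ i j → sym (E′≋ i j)) i j ⟩
            ((E′ +ᴹ E″) *ᴹ E′) i j                   ≈⟨ ∙-distribʳ (E′ i) (E″ i) (λ k → E′ k j) ⟩
            (E′ *ᴹ E′) i j + (E″ *ᴹ E′) i j          ≈⟨ +-cong (IsIdempotent.idempotent idem′ i j) (E″E′≋0 i j) ⟩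
            E′ i j + 0#                              ≈⟨ +-identityʳ _ ⟩
            E′ i j                                   ∎)
          decide : Dec (c l ≈ 0#) → E′ ≋ᴹ 0ᴹ ⊎ E″ ≋ᴹ 0ᴹ
          decide (yes c≈0) = inj₁ λ i j → trans (E′≋F i j) (trans (*-congʳ c≈0) (zeroˡ _))
          decide (no  c≉0) = inj₂ λ i j → +-cancelˡ (E′ i j) _ _ (begin
            E′ i j + E″ i j          ≈⟨ F≋ i j ⟨
            Fᶠ l i j                 ≈⟨ *-identityˡ _ ⟨
            1# * Fᶠ l i j            ≈⟨ *-congʳ (x*x≈x⇒x≈1 c≉0 (cc l)) ⟨
            c l * Fᶠ l i j           ≈⟨ E′≋F i j ⟨
            E′ i j                   ≈⟨ +-identityʳ _ ⟨
            E′ i j + 0#              ∎)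

        F-primitive : ∀ l → Primitive (Fᶠ l)
        F-primitive l = record
          { isIdempotent   = F-idem l
          ; nonzero        = F≉0 (toℕ≤s l)
          ; indecomposable = λ E′ E″ idem′ idem″ _ → F-indecomposable l E′ E″ idem′ idem″
          }

        F-distinct : ∀ k l → k ℕ.≤ s → l ℕ.≤ s → F k ≋ᴹ F l → k ≡ l
        F-distinct k l k≤s l≤s e with k ℕₚ.≟ l
        ... | yes k≡l = k≡l
        ... | no  k≢l = contradiction (λ i j → trans (sym (F-idempotent k≤s i j))
          (trans (*ᴹ-cong {A = F k} (λ _ _ → refl) e i j) (F-orthogonal k≤s l≤s k≢l i j))) (F≉0 k≤s)

        -- A primitive idempotent with nonzero coefficient at F l splits as F l
        -- plus an idempotent orthogonal to F l.
        module _ {M : Matrix n} (M-primitive : Primitive M) {c : Vector ℝ (suc s)} (M≋ : M ≋ᴹ comb c)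
                 (cc : ∀ l → c l * c l ≈ c l) {l : Fin (suc s)} (c≉0 : ¬ c l ≈ 0#) where

          rest : Vector ℝ (suc s)
          rest h = c h - δ l h

          rest≋ : M -ᴹ Fᶠ l ≋ᴹ comb rest
          rest≋ i j = +-cancelˡ (Fᶠ l i j) _ _ (begin
            Fᶠ l i j + (M i j - Fᶠ l i j)        ≈⟨ x≈y+[x-y] (M i j) (Fᶠ l i j) ⟨
            M i j                                ≈⟨ M≋ i j ⟩
            comb c i j                           ≈⟨ ∙-split c (δ l) (λ h → Fᶠ h i j) ⟩
            comb (δ l) i j + comb rest i j       ≈⟨ +-congʳ (F≋comb l i j) ⟨
            Fᶠ l i j + comb rest i j             ∎)

          rest-l : rest l ≈ 0#
          rest-l = x≈y⇒x-y≈0 (trans (x*x≈x⇒x≈1 c≉0 (cc l)) (sym (δ-diagonal l)))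

          rest-other : ∀ {h} → l ≢ h → rest h ≈ c h
          rest-other {h} l≢h = sym (trans (x≈y+[x-y] (c h) (δ l h))
            (trans (+-congʳ (δ-offDiagonal l≢h)) (+-identityˡ _)))

          rest-idempotent : ∀ h → rest h * rest h ≈ rest h
          rest-idempotent h with l Fin.≟ h
          ... | yes ≡.refl = trans (*-congʳ rest-l) (trans (zeroˡ _) (sym rest-l))
          ... | no  l≢h    = trans (*-cong (rest-other l≢h) (rest-other l≢h)) (trans (cc h) (sym (rest-other l≢h)))

          δ*rest : ∀ h → δ l h * rest h ≈ 0#
          δ*rest h with l Fin.≟ h
          ... | yes ≡.refl = trans (*-congˡ rest-l) (zeroʳ _)
          ... | no  l≢h    = trans (*-congʳ (δ-offDiagonal l≢h)) (zeroˡ _)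

          comb-zero : ∀ {d : Vector ℝ (suc s)} → (∀ h → d h ≈ 0#) → comb d ≋ᴹ 0ᴹ
          comb-zero d≈0 i j = sum-zero {suc s} λ h → trans (*-congʳ (d≈0 h)) (zeroˡ (Fᶠ h i j))

          primitive≋F : M ≋ᴹ Fᶠ l
          primitive≋F = [ (λ F≋0 → contradiction F≋0 (F≉0 (toℕ≤s l))) , (λ e i j → x-y≈0⇒x≈y (e i j)) ]′
            (IsPrimitiveIdempotent.indecomposable M-primitive (Fᶠ l) (M -ᴹ Fᶠ l)
              (F-idem l) (comb-idempotent rest rest≋ rest-idempotent)
              (λ i j → trans (*ᴹ-cong (F≋comb l) rest≋ i j)
                (trans (comb-* (δ l) rest i j) (comb-zero δ*rest i j)))
              (λ i j → trans (*ᴹ-cong rest≋ (F≋comb l) i j)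
                (trans (comb-* rest (δ l) i j) (comb-zero (λ h → trans (*-comm (rest h) (δ l h)) (δ*rest h)) i j)))
              (λ i j → x≈y+[x-y] (M i j) (Fᶠ l i j)))

        -- A nonzero element of the algebra has a nonzero coordinate, found by finite search;
        -- primitivity identifies it with the `F` at that coordinate.
        F-all : ∀ M → Primitive M → ∃[ k ] k ℕ.≤ s × M ≋ᴹ F k
        F-all M M-primitive = decide (any? λ l → ¬? (c l ≟ 0#))
          where
          idem = IsPrimitiveIdempotent.isIdempotent M-primitive
          c = proj₁ (idempotent⇒comb idem)
          M≋ = proj₁ (proj₂ (idempotent⇒comb idem))
          cc = proj₂ (proj₂ (idempotent⇒comb idem))
          decide : Dec (∃[ l ] ¬ c l ≈ 0#) → ∃[ k ] k ℕ.≤ s × M ≋ᴹ F k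
          decide (yes (l , c≉0)) = toℕ l , toℕ≤s l , primitive≋F M-primitive M≋ cc c≉0
          decide (no  none)      = contradiction
            (λ i j → trans (M≋ i j) (sum-zero {suc s} λ l → trans (*-congʳ (zeros l)) (zeroˡ (Fᶠ l i j))))
            (IsPrimitiveIdempotent.nonzero M-primitive)
            where
            zeros : ∀ l → c l ≈ 0#
            zeros l = decidable-stable (c l ≟ 0#) λ c≉0 → none (l , c≉0)

      agree⇒scheme : IsQPolynomialScheme X α F
      agree⇒scheme = record
        { isScheme    = record
          { nonempty  = R-nonempty
          ; diagonal  = λ i j → mk⇔ (R₀⇒≡ {i} {j}) λ { ≡.refl → sphere i }
          ; covering  = R-covering
          ; disjoint  = λ {k} {l} {i} {j} → R-unique {k} {l} {i} {j}
          ; symmetric = λ {k} {i} {j} r → trans (∙-comm (X j) (X i)) r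
          ; closed    = λ k l → let (c , A≋) = BM⇒comb (adjacency∈BM k) ; (d , B≋) = BM⇒comb (adjacency∈BM l)
                        in comb⇒BM (λ h → c h * d h) λ i j → trans (*ᴹ-cong A≋ B≋ i j) (comb-* c d i j)
          }
        ; idempotents = record
          { isPrimitive = for-index (λ k → Primitive (F k)) F-primitive
          ; distinct    = F-distinct
          ; all         = F-all
          }
        ; qPolynomial = λ k k≤s → q k , degree k k≤s , λ i j → begin
            N * F k i j                    ≈⟨ *-congˡ (E≋F k≤s i j) ⟨
            N * E k i j                    ≈⟨ ⟦values⟧ (q k) i j ⟩
            eval (q k) (X i ∙ X j)         ≈⟨ eval-cong (q k) (N*F₁ i j) ⟨
            eval (q k) (N * F 1 i j)       ∎
        }

    trace-inequality : trace (F s) ≤ μ s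
    trace-inequality = ≤-respʳ-≈ (sym excess) (x≤x+y (⟪⟫-nonNegative (E s -ᴹ F s)))

    trace-average : trace (F s) ≈ average (localMultiplicity (F s))
    trace-average = sym (trans (*-congˡ (sym (*-distribˡ-sum N (λ i → F s i i)))) (N⁻¹*N _))

theorem4p1 : {{𝓡 : RealNumbers}} (m n s : ℕ) → 1 ℕ.≤ m →
    (X : Fin n → Vector ℝ m) → AreDistinct X → OnSphere X →
    IsSpherical2Design X →
    (α : Vector ℝ s) → IsDistanceSet X s α →
    HasDegree X s →
    (F : ℕ → Matrix n) → AreProjectionMatrices X s F →
    (q : ∀ k → Poly≤ k) → ArePredegreePolynomials X α q →
    (trace (F s) ≈ average (localMultiplicity (F s)))
    × (trace (F s) ≤ eval (q s) (fromNat m))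
    × ((trace (F s) ≈ eval (q s) (fromNat m)) ⇔ IsQPolynomialScheme X α F)
theorem4p1 m n s 1≤m X distinct sphere design α distances _ F projections q predegree =
  trace-average , trace-inequality , mk⇔ (agree⇒scheme ∘ equality⇒agree) scheme⇒equality
  where
  open Excess 1≤m X distinct sphere design α distances F projections q predegree
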